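{- As $n\to\infty$, $ex_{bip}(n,C_6,C_8)=n^3+O(n^{5/2})$.
   Context: $C_k$ denotes the cycle with $k$ vertices. $ex_{bip}(n,C_{6},C_{8})$ denotes the maximum number of subgraphs isomorphic to $C_6$ in a bipartite graph on $n$ vertices that contains no subgraph isomorphic to $C_8$. -}

module Defs where

open import Data.Bool using (Bool; true; false)
open import Data.Empty using (⊥-elim)
open import Data.Fin using (Fin; zero; suc; toℕ)
import Data.Fin.Properties as Fin
open import Data.Fin.Subset using (Subset; _∈_; _∉_; inside; outside; ⊥)
open import Data.Fin.Subset.Properties using (_∈?_; anySubset?; ∉⊥)
open import Data.List as List using (List; []; _∷_; length; filter; cartesianProductWith)
open import Data.List.Extrema.Nat using (argmax; argmax-all; f[xs]≤f[argmax])
import Data.List.Membership.Propositional as List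
open import Data.List.Membership.Propositional using (lose)
open import Data.List.Membership.Propositional.Properties
  using (∈-cartesianProductWith⁺; ∈-filter⁺; ∈-filter⁻; ∈-map⁺; ∈-allFin)
open import Data.List.Properties using (filter-≐)
open import Data.List.Relation.Unary.All as All using (All; []; _∷_)
open import Data.List.Relation.Unary.All.Properties using (all-filter)
open import Data.List.Relation.Unary.AllPairs using ([]; _∷_)
open import Data.List.Relation.Unary.Any as Any using (here; there; satisfied)
open import Data.List.Relation.Unary.Unique.Propositional using (Unique)
import Data.List.Relation.Unary.Unique.Propositional.Properties as Unique
open import Data.Nat using (ℕ; zero; suc; _∸_; _≤_; _≤?_; s≤s; ∣_-_∣; _≟_)
open import Data.Nat.Properties using (∣-∣-comm; ∣n-n∣≡0)
open import Data.Product using (Σ; _×_; _,_; ∃; ∃-syntax; proj₁; proj₂)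
open import Data.Sum using (_⊎_; inj₁; inj₂)
open import Data.Vec as Vec using (Vec; []; _∷_; lookup; tabulate; replicate)
open import Data.Vec.Properties
  using (lookup∘tabulate; lookup-replicate; []=⇒lookup; lookup⇒[]=; ∷-injective)
open import Function using (id; _∘_; _⇔_; mk⇔; Equivalence)
open import Function.Definitions using (Injective)
open import Relation.Binary.PropositionalEquality
open import Relation.Nullary
open import Relation.Nullary.Decidable as Dec using (True; toWitness; map′; _×-dec_; _⊎-dec_; _→-dec_; ¬?)

private
  variable
    n k l : ℕ
    A : Set

record Graph (n : ℕ) : Set where
  constructor graph
  field
    nbhd : Vec (Subset n) n

  infix 4 _~_
  _~_ : Fin n → Fin n → Set
  u ~ v = v ∈ lookup nbhd u

  field
    ~-sym    : ∀ u v → u ~ v → v ~ u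
    ~-irrefl : ∀ u → ¬ (u ~ u)

Bipartite : Graph n → Set
Bipartite {n} G =
  ∃[ X ] ∀ (u v : Fin n) → u ~ v → (u ∈ X × v ∉ X) ⊎ (u ∉ X × v ∈ X)
  where open Graph G

-- On the vertices 0, …, k-1, consecutive ones and the pair {0 , k-1} are adjacent.
Consecutive : ∀ k → Fin k → Fin k → Set
Consecutive k i j = ∣ toℕ i - toℕ j ∣ ≡ 1 ⊎ ∣ toℕ i - toℕ j ∣ ≡ k ∸ 1

consecutive? : ∀ k i j → Dec (Consecutive k i j)
consecutive? k i j = (∣ toℕ i - toℕ j ∣ ≟ 1) ⊎-dec (∣ toℕ i - toℕ j ∣ ≟ k ∸ 1)

cycleNbhd : ∀ k → Vec (Subset k) k
cycleNbhd k = tabulate λ i → tabulate λ j → does (consecutive? k i j)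

∈-cycleNbhd : ∀ k i j → j ∈ lookup (cycleNbhd k) i ⇔ Consecutive k i j
∈-cycleNbhd k i j = mk⇔ to from
  where
  eq : lookup (lookup (cycleNbhd k) i) j ≡ does (consecutive? k i j)
  eq = trans (cong (λ S → lookup S j) (lookup∘tabulate _ i)) (lookup∘tabulate _ j)

  to : j ∈ lookup (cycleNbhd k) i → Consecutive k i j
  to j∈ = does-true (consecutive? k i j) (trans (sym eq) ([]=⇒lookup j∈))
    where
    does-true : (a? : Dec A) → does a? ≡ true → A
    does-true (yes a) _ = a
    does-true (no _)  ()

  from : Consecutive k i j → j ∈ lookup (cycleNbhd k) i
  from c = lookup⇒[]= j _ (trans eq (Dec.dec-true (consecutive? k i j) c))

Cycle : ∀ k → {True (3 ≤? k)} → Graph k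
Cycle k {3≤k} = graph (cycleNbhd k)
  (λ i j → Equivalence.from (∈-cycleNbhd k j i) ∘ symm i j ∘ Equivalence.to (∈-cycleNbhd k i j))
  (λ i → irr (toWitness 3≤k) i ∘ Equivalence.to (∈-cycleNbhd k i i))
  where
  symm : ∀ i j → Consecutive k i j → Consecutive k j i
  symm i j c rewrite ∣-∣-comm (toℕ i) (toℕ j) = c

  irr : 3 ≤ k → ∀ i → ¬ Consecutive k i i
  irr (s≤s (s≤s _)) i c rewrite ∣n-n∣≡0 (toℕ i) with c
  ... | inj₁ ()
  ... | inj₂ ()

-- A vertex set together with an adjacency matrix.  That these form a subgraph
-- of a given graph is a separate predicate, so that equal subgraphs are
-- propositionally equal and each is counted once.
record VE (n : ℕ) : Set where
  constructor ve
  field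
    verts : Subset n
    nbhd  : Vec (Subset n) n

  infix 4 _~_
  _~_ : Fin n → Fin n → Set
  u ~ v = v ∈ lookup nbhd u

_⊑_ : VE n → Graph n → Set
S ⊑ G = (∀ u v → u S.~ v → v S.~ u)
      × (∀ u v → u S.~ v → u ∈ S.verts)
      × (∀ u v → u S.~ v → u G.~ v)
  where
  module S = VE S
  module G = Graph G

_≅_ : Graph k → VE n → Set
_≅_ {k} {n} F S = ∃[ f ] IsIso f
  where
  module F = Graph F
  module S = VE S
  IsIso : (Fin k → Fin n) → Set
  IsIso f = Injective _≡_ _≡_ f
          × (∀ v → v ∈ S.verts ⇔ (∃[ i ] f i ≡ v))
          × (∀ i j → i F.~ j ⇔ f i S.~ f j)

IsCopy : Graph k → Graph n → VE n → Set
IsCopy F G S = S ⊑ G × F ≅ S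

Free : Graph k → Graph n → Set
Free F G = ¬ (∃[ S ] IsCopy F G S)

vectors : List A → ∀ m → List (Vec A m)
vectors xs zero    = [] ∷ []
vectors xs (suc m) = cartesianProductWith _∷_ xs (vectors xs m)

∈-vectors : {xs : List A} → (∀ x → x List.∈ xs) → ∀ {m} (v : Vec A m) → v List.∈ vectors xs m
∈-vectors all []      = here refl
∈-vectors all (x ∷ v) = ∈-cartesianProductWith⁺ _∷_ (all x) (∈-vectors all v)

vectors-unique : {xs : List A} → Unique xs → ∀ m → Unique (vectors xs m)
vectors-unique xs! zero    = [] ∷ []
vectors-unique xs! (suc m) =
  Unique.cartesianProductWith⁺ _∷_ ∷-injective xs! (vectors-unique xs! m)

subsets : ∀ n → List (Subset n)
subsets n = vectors (inside ∷ outside ∷ []) n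

∈-subsets : (S : Subset n) → S List.∈ subsets n
∈-subsets = ∈-vectors λ { true → here refl ; false → there (here refl) }

subsets-unique : ∀ n → Unique (subsets n)
subsets-unique = vectors-unique (((λ ()) ∷ []) ∷ [] ∷ [])

matrices : ∀ n → List (Vec (Subset n) n)
matrices n = vectors (subsets n) n

ves : ∀ n → List (VE n)
ves n = cartesianProductWith ve (subsets n) (matrices n)

∈-ves : (S : VE n) → S List.∈ ves n
∈-ves (ve V N) = ∈-cartesianProductWith⁺ ve (∈-subsets V) (∈-vectors ∈-subsets N)

ves-unique : ∀ n → Unique (ves n)
ves-unique n = Unique.cartesianProductWith⁺ ve (λ { refl → refl , refl })
  (subsets-unique n) (vectors-unique (subsets-unique n) n)

infix 3 _⇔-dec_
_⇔-dec_ : {A B : Set} → Dec A → Dec B → Dec (A ⇔ B)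
a? ⇔-dec b? = map′ (λ (f , g) → mk⇔ f g) (λ e → Equivalence.to e , Equivalence.from e)
  ((a? →-dec b?) ×-dec (b? →-dec a?))

all₂? : {P : Fin k → Fin l → Set} → (∀ i j → Dec (P i j)) → Dec (∀ i j → P i j)
all₂? P? = Fin.all? λ i → Fin.all? λ j → P? i j

bipartite? : (G : Graph n) → Dec (Bipartite G)
bipartite? G = anySubset? λ X → all₂? λ u v →
  (v ∈? lookup nbhd u) →-dec
  (((u ∈? X) ×-dec ¬? (v ∈? X)) ⊎-dec (¬? (u ∈? X) ×-dec (v ∈? X)))
  where open Graph G

_⊑?_ : (S : VE n) (G : Graph n) → Dec (S ⊑ G)
S ⊑? G = all₂? (λ u v → (u S~? v) →-dec (v S~? u))
   ×-dec all₂? (λ u v → (u S~? v) →-dec (u ∈? VE.verts S))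
   ×-dec all₂? (λ u v → (u S~? v) →-dec (v ∈? lookup (Graph.nbhd G) u))
  where
  _S~?_ : ∀ u v → Dec (VE._~_ S u v)
  u S~? v = v ∈? lookup (VE.nbhd S) u

_≅?_ : (F : Graph k) (S : VE n) → Dec (F ≅ S)
_≅?_ {k} {n} F S = map′
  (λ p → let (f , iso) = satisfied p in lookup f , toIso iso)
  (λ (f , iso) → lose (∈-vectors ∈-allFin (tabulate f)) (fromIso f iso))
  (Any.any? iso? (vectors (List.allFin n) k))
  where
  module F = Graph F
  module S = VE S
  Iso : (Fin k → Fin n) → Set
  Iso f = (∀ i j → f i ≡ f j → i ≡ j)
        × (∀ v → v ∈ S.verts ⇔ (∃[ i ] f i ≡ v))
        × (∀ i j → i F.~ j ⇔ f i S.~ f j)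

  iso? : (f : Vec (Fin n) k) → Dec (Iso (lookup f))
  iso? f = all₂? (λ i j → (lookup f i Fin.≟ lookup f j) →-dec (i Fin.≟ j))
     ×-dec Fin.all? (λ v → (v ∈? S.verts) ⇔-dec Fin.any? (λ i → lookup f i Fin.≟ v))
     ×-dec all₂? (λ i j → (j ∈? lookup F.nbhd i) ⇔-dec (lookup f j ∈? lookup S.nbhd (lookup f i)))

  toIso : ∀ {f} → Iso f → _
  toIso (inj , im , adj) = (λ {i} {j} → inj i j) , im , adj

  fromIso : ∀ f → _ → Iso (lookup (tabulate f))
  fromIso f (inj , im , adj)
    = (λ i j e → inj (trans (sym (eq i)) (trans e (eq j))))
    , (λ v → mk⇔ (λ v∈ → let (i , e) = Equivalence.to (im v) v∈ in i , trans (eq i) e)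
                 (λ (i , e) → Equivalence.from (im v) (i , trans (sym (eq i)) e)))
    , (λ i j → subst₂ (λ x y → i F.~ j ⇔ x S.~ y) (sym (eq i)) (sym (eq j)) (adj i j))
    where
    eq : ∀ i → lookup (tabulate f) i ≡ f i
    eq = lookup∘tabulate f

isCopy? : (F : Graph k) (G : Graph n) (S : VE n) → Dec (IsCopy F G S)
isCopy? F G S = (S ⊑? G) ×-dec (F ≅? S)

free? : (F : Graph k) (G : Graph n) → Dec (Free F G)
free? {n = n} F G = ¬? (map′ satisfied (λ (S , c) → lose (∈-ves S) c)
  (Any.any? (isCopy? F G) (ves n)))

copies : Graph k → (G : Graph n) → List (VE n)
copies {n = n} F G = filter (isCopy? F G) (ves n)

∈-copies : (F : Graph k) (G : Graph n) (S : VE n) → S List.∈ copies F G ⇔ IsCopy F G S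
∈-copies F G S = mk⇔ (proj₂ ∘ ∈-filter⁻ (isCopy? F G) {xs = ves _})
                     (∈-filter⁺ (isCopy? F G) (∈-ves S))

copies-unique : (F : Graph k) (G : Graph n) → Unique (copies F G)
copies-unique {n = n} F G = Unique.filter⁺ (isCopy? F G) (ves-unique n)

#copies : Graph k → Graph n → ℕ
#copies F G = length (copies F G)

Admissible : Graph l → Graph n → Set
Admissible H G = Bipartite G × Free H G

IsExBip : (n : ℕ) → Graph k → Graph l → ℕ → Set
IsExBip n F H m =
    (∃[ G ] Admissible {n = n} H G × #copies F G ≡ m)
  × (∀ G → Admissible {n = n} H G → #copies F G ≤ m)

private
  no-edge : ∀ (u v : Fin n) → v ∉ lookup (replicate n (⊥ {n})) u
  no-edge u v v∈ = ∉⊥ (subst (v ∈_) (lookup-replicate u ⊥) v∈)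

  empty : ∀ n → Graph n
  empty n = graph (replicate n ⊥) (λ u v → ⊥-elim ∘ no-edge u v) (λ u → no-edge u u)

  IsSimple : Vec (Subset n) n → Set
  IsSimple N = (∀ u v → v ∈ lookup N u → u ∈ lookup N v) × (∀ u → u ∉ lookup N u)

  isSimple? : (N : Vec (Subset n) n) → Dec (IsSimple N)
  isSimple? N = all₂? (λ u v → (v ∈? lookup N u) →-dec (u ∈? lookup N v))
          ×-dec Fin.all? (λ u → ¬? (u ∈? lookup N u))

  toGraph : Vec (Subset n) n → Graph n
  toGraph N with isSimple? N
  ... | yes (s , i) = graph N s i
  ... | no  _       = empty _

  nbhd-toGraph : (G : Graph n) → Graph.nbhd (toGraph (Graph.nbhd G)) ≡ Graph.nbhd G
  nbhd-toGraph (graph N s i) with isSimple? N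
  ... | yes _ = refl
  ... | no ¬p = ⊥-elim (¬p (s , i))

  #copies-cong : (F : Graph k) (G G′ : Graph n) → Graph.nbhd G ≡ Graph.nbhd G′ →
                 #copies F G ≡ #copies F G′
  #copies-cong F (graph N _ _) (graph .N _ _) refl = refl

  admissible-cong : (H : Graph k) (G G′ : Graph n) → Graph.nbhd G ≡ Graph.nbhd G′ →
                    Admissible H G → Admissible H G′
  admissible-cong H (graph N _ _) (graph .N _ _) refl p = p

-- The maximum exists as soon as H has an edge, since then the empty graph is H-free.
maxExBip : (n : ℕ) (F : Graph k) (H : Graph l) → (∃[ i ] ∃[ j ] Graph._~_ H i j) →
           ∃[ m ] IsExBip n F H m
maxExBip {k} {l} n F H (i , j , i~j) =
  #copies F best
  , (best , argmax-all (#copies F) {P = Admissible H} empty-admissible (all-filter admissible? graphs) , refl)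
  , λ G a → let G′ = toGraph (Graph.nbhd G) in
      subst (_≤ #copies F best) (#copies-cong F G′ G (nbhd-toGraph G))
        (All.lookup (f[xs]≤f[argmax] {f = #copies F} (empty n) admissibles)
          (∈-filter⁺ admissible? (∈-map⁺ toGraph (∈-vectors ∈-subsets (Graph.nbhd G)))
            (admissible-cong H G G′ (sym (nbhd-toGraph G)) a)))
  where
  admissible? : (G : Graph n) → Dec (Admissible H G)
  admissible? G = bipartite? G ×-dec free? H G

  empty-admissible : Admissible H (empty n)
  empty-admissible =
    (⊥ , λ u v u~v → ⊥-elim (no-edge u v u~v)) ,
    λ (S , (_ , _ , S⊆) , f , _ , _ , adj) →
      no-edge (f i) (f j) (S⊆ _ _ (Equivalence.to (adj i j) i~j))

  graphs : List (Graph n)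
  graphs = List.map toGraph (matrices n)

  admissibles : List (Graph n)
  admissibles = filter admissible? graphs

  best : Graph n
  best = argmax (#copies F) (empty n) admissibles

cycle-edge : ∀ l {3≤l : True (3 ≤? l)} → ∃[ i ] ∃[ j ] Graph._~_ (Cycle l {3≤l}) i j
cycle-edge l@(suc (suc _)) = zero , suc zero , Equivalence.from (∈-cycleNbhd l zero (suc zero)) (inj₁ refl)

-- ex_bip(n, C_k, C_l)
exbip : (n k l : ℕ) {3≤k : True (3 ≤? k)} {3≤l : True (3 ≤? l)} → ℕ
exbip n k l {3≤k} {3≤l} =
  proj₁ (maxExBip n (Cycle k {3≤k}) (Cycle l {3≤l}) (cycle-edge l {3≤l}))

exbip-isExBip : ∀ n k l {3≤k : True (3 ≤? k)} {3≤l : True (3 ≤? l)} →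
  IsExBip n (Cycle k {3≤k}) (Cycle l {3≤l}) (exbip n k l {3≤k} {3≤l})
exbip-isExBip n k l {3≤k} {3≤l} =
  proj₂ (maxExBip n (Cycle k {3≤k}) (Cycle l {3≤l}) (cycle-edge l {3≤l}))

{-# OPTIONS --safe #-}
-- Call two vertices fat if they have at least four common neighbours, and light otherwise.  Let
-- x₀ y₂ x₁ y₀ x₂ y₁ be a hexagon in a C₈-free bipartite graph.  The two x's other than xᵢ and the
-- two y's other than yⱼ cannot both be fat pairs when i ≠ j, since new common neighbours would
-- extend the hexagon to a C₈.  If all pairs of x's are fat, then y determines the set of the x's,
-- so there are at most n³ such hexagons, counting both sides.  Otherwise the two x's other than
-- xᵢ and the two y's other than yᵢ are both light for some i, say i = 2, and after exchanging
-- the sides y₂ is not fat with both y₀ and y₁.  The paths y₁ x₀ y₂ x₁ y₀ between given ends pairwise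
-- meet inside, again by C₈-freeness, so comparison with one fixed path leaves O(deg y₀ + deg y₁)
-- hexagons for each pair y₀ y₁, hence O(n m) in total, with m the sum of the
-- degrees.  Finally m² = O(n³): by Cauchy–Schwarz m² ≤ n ∑ deg², the sum ∑ deg² counts pairs of
-- vertices by their common neighbours, and the fat pairs inside a neighbourhood form a graph
-- without paths on four vertices, so they are linearly many.  The lower bound comes from K₃,ₙ₋₃.

module Submission where

open import Defs
import Data.Nat.Properties as ℕ
open import Algebra.Properties.Semiring.Sum ℕ.+-*-semiring
  using (sum; sum-syntax; sum-cong-≗; ∑-distrib-+; ∑-comm; *-distribˡ-sum; *-distribʳ-sum)
open import Data.Bool using (true; false; if_then_else_)
open import Data.Empty using (⊥; ⊥-elim)
open import Data.Fin as Fin using (Fin; zero; suc; toℕ; _↑ʳ_; _↑ˡ_; punchIn)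
open import Data.Fin.Patterns using (0F; 1F; 2F; 3F; 4F; 5F; 6F; 7F)
open import Data.Fin.Permutation
  using (Permutation′; permutation; transpose; flip; _⟨$⟩ʳ_; _⟨$⟩ˡ_; inverseʳ; inverseˡ) renaming (id to idₚ)
import Data.Fin.Properties as Fin
import Data.Fin.Subset as Subset
import Data.Fin.Subset.Properties as Subset
open import Data.List as List
  using (List; []; _∷_; _++_; length; filter; allFin; lookup; take; concatMap; cartesianProduct; cartesianProductWith)
open import Data.List.Membership.Propositional using (_∈_; _∉_; find; lose)
open import Data.List.Membership.Propositional.Properties
  using (∈-filter⁺; ∈-filter⁻; ∈-allFin; ∈-lookup; ∈-++⁺ˡ; ∈-++⁺ʳ; ∈-map⁺; ∈-concatMap⁺; ∈-cartesianProduct⁺)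
open import Data.List.Properties using (length-tabulate; length-filter; length-map; length-++; length-take; take-all)
open import Data.List.Relation.Unary.All as All using (All; []; _∷_)
open import Data.List.Relation.Unary.All.Properties using (¬All⇒Any¬)
open import Data.List.Relation.Unary.AllPairs using ([]; _∷_)
open import Data.List.Relation.Unary.Any as Any using (here; there; index)
open import Data.List.Relation.Unary.Any.Properties using (lookup-index)
open import Data.List.Relation.Unary.Unique.Propositional using (Unique)
import Data.List.Relation.Unary.Unique.Propositional.Properties as Unique
open import Data.Nat using (ℕ; zero; suc; _+_; _*_; _^_; _≤_; _<_; z≤n; s≤s; _≤?_; _<?_; ∣_-_∣)
open import Data.Nat.Properties
open import Data.Nat.Solver using (module +-*-Solver)
open import Data.Nat.Tactic.RingSolver using (solve-∀)
open import Data.Product using (_×_; _,_; ∃-syntax; proj₁; proj₂)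
open import Data.Sum using (_⊎_; inj₁; inj₂)
import Data.Sum.Properties as Sum
open import Data.Vec as Vec using (Vec; []; _∷_)
open import Data.Vec.Properties using (lookup∘tabulate; []=⇒lookup; lookup⇒[]=)
open import Function using (_∘_; _⇔_; mk⇔; Equivalence)
open import Function.Definitions using (Injective)
open import Relation.Binary using (tri<; tri≈; tri>)
open import Relation.Binary.PropositionalEquality hiding ([_])
open import Relation.Nullary
open import Relation.Nullary.Decidable using (from-yes; ¬?; _×-dec_; _⊎-dec_; _→-dec_; dec-true)
open import Relation.Unary using (Decidable)

-- Sums and counting

∑-mono : ∀ {n} {f g : Fin n → ℕ} → (∀ i → f i ≤ g i) → sum f ≤ sum g
∑-mono {zero}  f≤g = z≤n
∑-mono {suc n} f≤g = +-mono-≤ (f≤g zero) (∑-mono (f≤g ∘ suc))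

∑-const : ∀ n c → ∑[ i < n ] c ≡ n * c
∑-const zero    c = refl
∑-const (suc n) c = cong (c +_) (∑-const n c)

2ab≤a²+b² : ∀ a b → 2 * (a * b) ≤ a * a + b * b
2ab≤a²+b² a b with ≤-total a b
... | inj₁ a≤b with k , refl ← m≤n⇒∃[o]m+o≡n a≤b =
  subst (2 * (a * (a + k)) ≤_) (identity a k) (m≤m+n _ (k * k))
  where
  identity : ∀ a k → 2 * (a * (a + k)) + k * k ≡ a * a + (a + k) * (a + k)
  identity = solve-∀
... | inj₂ b≤a with k , refl ← m≤n⇒∃[o]m+o≡n b≤a =
  subst (2 * ((b + k) * b) ≤_) (identity b k) (m≤m+n _ (k * k))
  where
  identity : ∀ b k → 2 * ((b + k) * b) + k * k ≡ (b + k) * (b + k) + b * b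
  identity = solve-∀

-- Induction on `n`: the cross term 2as of the square is a sum of products 2a·d(i), each at most a²
-- + d(i)².
cauchy-schwarz : ∀ {n} (d : Fin n → ℕ) → sum d * sum d ≤ n * ∑[ i < n ] (d i * d i)
cauchy-schwarz {zero}  d = z≤n
cauchy-schwarz {suc n} d = begin
  (a + s) * (a + s)                ≡⟨ expand a s ⟩
  a * a + 2 * (a * s) + s * s      ≤⟨ +-mono-≤ (+-monoʳ-≤ (a * a) cross) (cauchy-schwarz (d ∘ suc)) ⟩
  a * a + (n * (a * a) + q) + n * q ≡⟨ collect (a * a) n q ⟩
  suc n * (a * a + q)              ∎
  where
  open ≤-Reasoning
  a s q : ℕ
  a = d zero
  s = sum (d ∘ suc)
  q = ∑[ i < n ] (d (suc i) * d (suc i))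

  expand : ∀ a s → (a + s) * (a + s) ≡ a * a + 2 * (a * s) + s * s
  expand = solve-∀
  collect : ∀ b n q → b + (n * b + q) + n * q ≡ suc n * (b + q)
  collect = solve-∀

  cross : 2 * (a * s) ≤ n * (a * a) + q
  cross = begin
    2 * (a * s)                                  ≡⟨ cong (2 *_) (*-distribˡ-sum a (d ∘ suc)) ⟩
    2 * ∑[ i < n ] (a * d (suc i))               ≡⟨ *-distribˡ-sum 2 (λ i → a * d (suc i)) ⟩
    ∑[ i < n ] (2 * (a * d (suc i)))             ≤⟨ ∑-mono (λ i → 2ab≤a²+b² a (d (suc i))) ⟩
    ∑[ i < n ] (a * a + d (suc i) * d (suc i))   ≡⟨ ∑-distrib-+ {n} (λ _ → a * a) (λ i → d (suc i) * d (suc i)) ⟩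
    ∑[ i < n ] (a * a) + q                       ≡⟨ cong (_+ q) (∑-const n (a * a)) ⟩
    n * (a * a) + q                              ∎

-- The Iverson bracket, which turns double counting into an exchange of sums.
[_] : ∀ {P : Set} → Dec P → ℕ
[ p? ] = if does p? then 1 else 0

[]-yes : ∀ {P : Set} (p? : Dec P) → P → [ p? ] ≡ 1
[]-yes (yes _) p = refl
[]-yes (no ¬p) p = contradiction p ¬p

[]≤ : ∀ {P : Set} (p? : Dec P) {k} → (P → 1 ≤ k) → [ p? ] ≤ k
[]≤ (yes p) f = f p
[]≤ (no _)  f = z≤n

[]*≤ : ∀ {P : Set} (p? : Dec P) {a k} → (P → a ≤ k) → [ p? ] * a ≤ k
[]*≤ (yes p) {a} f = subst (_≤ _) (sym (*-identityˡ a)) (f p)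
[]*≤ (no _)      f = z≤n

[]-⇔ : ∀ {P Q : Set} (p? : Dec P) (q? : Dec Q) → (P → Q) → (Q → P) → [ p? ] ≡ [ q? ]
[]-⇔ (yes _) (yes _) f g = refl
[]-⇔ (yes p) (no ¬q) f g = contradiction (f p) ¬q
[]-⇔ (no ¬p) (yes q) f g = contradiction (g q) ¬p
[]-⇔ (no _)  (no _)  f g = refl

# : ∀ {n} {P : Fin n → Set} → Decidable P → ℕ
# {n} P? = length (filter P? (allFin n))

#-∑ : ∀ {n} {P : Fin n → Set} (P? : Decidable P) → # P? ≡ ∑[ i < n ] [ P? i ]
#-∑ {n} {P} P? = go (λ i → i)
  where
  -- `allFin` is a tabulation, so the induction runs over an arbitrary tabulated function.
  go : ∀ {m} (f : Fin m → Fin n) → length (filter P? (List.tabulate f)) ≡ ∑[ i < m ] [ P? (f i) ]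
  go {zero}  f = refl
  go {suc m} f with does (P? (f zero))
  ... | true  = cong suc (go (f ∘ suc))
  ... | false = go (f ∘ suc)

length-concatMap-tabulate : ∀ {m} {A B : Set} (f : A → List B) (g : Fin m → A) →
  length (concatMap f (List.tabulate g)) ≡ ∑[ i < m ] length (f (g i))
length-concatMap-tabulate {zero}  f g = refl
length-concatMap-tabulate {suc m} f g = trans (length-++ (f (g zero)))
  (cong (length (f (g zero)) +_) (length-concatMap-tabulate f (g ∘ suc)))

length-concatMap≤ : ∀ {A B : Set} (f : A → List B) {k} → (∀ x → length (f x) ≤ k) →
  ∀ xs → length (concatMap f xs) ≤ length xs * k
length-concatMap≤ f f≤ []       = z≤n
length-concatMap≤ f {k} f≤ (x ∷ xs) = begin
  length (concatMap f (x ∷ xs))              ≡⟨ length-++ (f x) ⟩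
  length (f x) + length (concatMap f xs)     ≤⟨ +-mono-≤ (f≤ x) (length-concatMap≤ f f≤ xs) ⟩
  k + length xs * k                          ∎
  where open ≤-Reasoning

lookup-injective : ∀ {A : Set} {xs : List A} → Unique xs → ∀ i j → lookup xs i ≡ lookup xs j → i ≡ j
lookup-injective (x∉ ∷ xs!) zero    zero    e = refl
lookup-injective (x∉ ∷ xs!) zero    (suc j) e = contradiction e (All.lookup x∉ (∈-lookup j))
lookup-injective (x∉ ∷ xs!) (suc i) zero    e = contradiction (sym e) (All.lookup x∉ (∈-lookup i))
lookup-injective (x∉ ∷ xs!) (suc i) (suc j) e = cong suc (lookup-injective xs! i j e)

-- Each position of `xs` is sent to the position of its code in `ys`. A relation in place of a
-- function allows several codes per element, as a hexagon has several labellings, while no code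
-- belongs to two elements.
length-injects : ∀ {A B : Set} (R : A → B → Set) {xs ys} → Unique xs →
  (∀ {a} → a ∈ xs → ∃[ b ] b ∈ ys × R a b) →
  (∀ {a a′ b} → R a b → R a′ b → a ≡ a′) →
  length xs ≤ length ys
length-injects {B = B} R {xs} {ys} xs! code inj = Fin.injective⇒≤ {f = λ i → index (b∈ i)} λ {i} {j} e →
  lookup-injective xs! i j (inj (R-code i)
    (subst (R _) (sym (trans (lookup-index (b∈ i)) (trans (cong (lookup ys) e) (sym (lookup-index (b∈ j)))))) (R-code j)))
  where
  coded : ∀ i → ∃[ b ] b ∈ ys × R (lookup xs i) b
  coded i = code (∈-lookup i)
  b∈ : ∀ i → proj₁ (coded i) ∈ ys
  b∈ i = proj₁ (proj₂ (coded i))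
  R-code : ∀ i → R (lookup xs i) (proj₁ (coded i))
  R-code i = proj₂ (proj₂ (coded i))

-- Pigeonhole: if every witness of `P` lay in `ys`, the identity would inject the witnesses into a
-- shorter list. Eight-cycles are later built by choosing new common neighbours this way.
#-fresh : ∀ {n} {P : Fin n → Set} (P? : Decidable P) (ys : List (Fin n)) → length ys < # P? →
  ∃[ x ] P x × x ∉ ys
#-fresh {n} {P} P? ys ys<P with All.all? (λ x → Any.any? (x Fin.≟_) ys) (filter P? (allFin n))
... | yes all∈ = contradiction
  (length-injects _≡_ (Unique.filter⁺ P? (Unique.allFin⁺ n))
    (λ {a} a∈ → a , All.lookup all∈ a∈ , refl) (λ { refl refl → refl }))
  (<⇒≱ ys<P)
... | no ¬all∈ = pick (¬All⇒Any¬ (λ x → Any.any? (x Fin.≟_) ys) _ ¬all∈)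
  where
  pick : Any.Any (_∉ ys) (filter P? (allFin n)) → ∃[ x ] P x × x ∉ ys
  pick any with x , x∈ , x∉ ← find any = x , proj₂ (∈-filter⁻ P? {xs = allFin n} x∈) , x∉

#-single : ∀ {n} (u : Fin n) → # (u Fin.≟_) ≤ 1
#-single u with # (u Fin.≟_) ≤? 1
... | yes p = p
... | no ¬p with x , refl , x∉ ← #-fresh (u Fin.≟_) (u ∷ []) (≰⇒> ¬p) = contradiction (here refl) x∉

-- In a loopless graph without paths on four vertices every edge has an end of
-- degree at most two.  Loops are allowed here, whence the bound three.
∑#-P₄-free : ∀ {n} {P : Fin n → Set} {H : Fin n → Fin n → Set}
  (P? : Decidable P) (H? : ∀ u → Decidable (H u)) →
  (∀ {u v} → H u v → P u) → (∀ {u v} → H u v → H v u) →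
  (∀ {x u v z} → Unique (x ∷ u ∷ v ∷ z ∷ []) → H x u → H u v → H v z → ⊥) →
  ∑[ u < n ] # (H? u) ≤ 7 * # P?
∑#-P₄-free {n} {P} {H} P? H? H⇒P H-sym P₄-free = begin
  ∑[ u < n ] h u
    ≡⟨ sum-cong-≗ {n} (λ u → #-∑ (H? u)) ⟩
  ∑[ u < n ] ∑[ v < n ] [ H? u v ]
    -- Each arc is a loop or is charged to an end with at most three neighbours. A vertex of `P` is
    -- charged at most 1 + 3 + 3 = 7 times: for its loop, as first end and as second end.
    ≤⟨ ∑-mono (λ u → ∑-mono (pointwise u)) ⟩
  ∑[ u < n ] ∑[ v < n ] ([ P? u ] * [ u Fin.≟ v ] + (g u v + g v u))
    ≡⟨ sum-cong-≗ {n} (λ u → trans (∑-distrib-+ (λ v → [ P? u ] * [ u Fin.≟ v ]) (λ v → g u v + g v u))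
         (cong₂ _+_ (sym (*-distribˡ-sum [ P? u ] (λ v → [ u Fin.≟ v ]))) (∑-distrib-+ (g u) (λ v → g v u)))) ⟩
  ∑[ u < n ] ([ P? u ] * ∑[ v < n ] [ u Fin.≟ v ] + (sum (g u) + ∑[ v < n ] g v u))
    ≡⟨ trans (∑-distrib-+ (λ u → [ P? u ] * ∑[ v < n ] [ u Fin.≟ v ]) (λ u → sum (g u) + ∑[ v < n ] g v u))
         (cong (∑[ u < n ] ([ P? u ] * ∑[ v < n ] [ u Fin.≟ v ]) +_)
           (trans (∑-distrib-+ (λ u → sum (g u)) (λ u → ∑[ v < n ] g v u))
             (cong (∑[ u < n ] sum (g u) +_) (∑-comm (λ u v → g v u))))) ⟩
  ∑[ u < n ] ([ P? u ] * ∑[ v < n ] [ u Fin.≟ v ]) + (∑[ u < n ] sum (g u) + ∑[ u < n ] sum (g u))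
    ≤⟨ +-mono-≤ (∑-mono loops) (+-mono-≤ (∑-mono low) (∑-mono low)) ⟩
  ∑[ u < n ] ([ P? u ] * 1) + (∑[ u < n ] ([ P? u ] * 3) + ∑[ u < n ] ([ P? u ] * 3))
    ≡⟨ cong₂ _+_ (total 1) (cong₂ _+_ (total 3) (total 3)) ⟩
  # P? * 1 + (# P? * 3 + # P? * 3)
    ≡⟨ arith (# P?) ⟩
  7 * # P? ∎
  where
  open ≤-Reasoning
  h : Fin n → ℕ
  h u = # (H? u)

  g : Fin n → Fin n → ℕ
  g u v = [ h u ≤? 3 ] * [ H? u v ]

  arith : ∀ p → p * 1 + (p * 3 + p * 3) ≡ 7 * p
  arith = solve-∀

  total : ∀ k → ∑[ u < n ] ([ P? u ] * k) ≡ # P? * k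
  total k = trans (sym (*-distribʳ-sum k (λ u → [ P? u ]))) (cong (_* k) (sym (#-∑ P?)))

  loops : ∀ u → [ P? u ] * ∑[ v < n ] [ u Fin.≟ v ] ≤ [ P? u ] * 1
  loops u = *-monoʳ-≤ [ P? u ] (subst (_≤ 1) (#-∑ (u Fin.≟_)) (#-single u))

  low : ∀ u → sum (g u) ≤ [ P? u ] * 3
  low u with P? u
  ... | no ¬Pu = subst (_≤ 0) (sym (trans (sum-cong-≗ {n} zeros) (trans (∑-const n 0) (*-zeroʳ n)))) z≤n
    where
    zeros : ∀ v → g u v ≡ 0
    zeros v with H? u v
    ... | yes Huv = contradiction (H⇒P Huv) ¬Pu
    ... | no _    = *-zeroʳ [ h u ≤? 3 ]
  ... | yes _  = subst (_≤ 3) 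
    (trans (cong ([ h u ≤? 3 ] *_) (#-∑ (H? u))) (*-distribˡ-sum [ h u ≤? 3 ] (λ v → [ H? u v ])))
    ([]*≤ (h u ≤? 3) (λ h≤3 → h≤3))

  -- Otherwise a neighbour `x` of `u` and a neighbour `z` of `v` make x u v z a path; four
  -- neighbours of `v` leave one that avoids `x`, `u` and `v` itself.
  low-end : ∀ {u v} → u ≢ v → H u v → h u ≤ 3 ⊎ h v ≤ 3
  low-end {u} {v} u≢v Huv with h u ≤? 3 | h v ≤? 3
  ... | yes p | _     = inj₁ p
  ... | _     | yes p = inj₂ p
  ... | no ¬p | no ¬q
    with x , Hux , x∉ ← #-fresh (H? u) (u ∷ v ∷ []) (≤-trans (n≤1+n 3) (≰⇒> ¬p))
    with z , Hvz , z∉ ← #-fresh (H? v) (x ∷ u ∷ v ∷ []) (≰⇒> ¬q) =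
    contradiction (P₄-free unique (H-sym Hux) Huv Hvz) λ ()
    where
    unique : Unique (x ∷ u ∷ v ∷ z ∷ [])
    unique = ((x∉ ∘ here) ∷ (x∉ ∘ there ∘ here) ∷ (z∉ ∘ here ∘ sym) ∷ [])
           ∷ (u≢v ∷ (z∉ ∘ there ∘ here ∘ sym) ∷ []) ∷ ((z∉ ∘ there ∘ there ∘ here ∘ sym) ∷ []) ∷ [] ∷ []

  pointwise : ∀ u v → [ H? u v ] ≤ [ P? u ] * [ u Fin.≟ v ] + (g u v + g v u)
  pointwise u v = []≤ (H? u v) λ Huv → go Huv (u Fin.≟ v)
    where
    go : H u v → Dec (u ≡ v) → 1 ≤ [ P? u ] * [ u Fin.≟ v ] + (g u v + g v u)
    go Huv (yes u≡v) rewrite []-yes (P? u) (H⇒P Huv) | []-yes (u Fin.≟ v) u≡v = s≤s z≤n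
    go Huv (no u≢v) with low-end u≢v Huv
    ... | inj₁ p rewrite []-yes (h u ≤? 3) p | []-yes (H? u v) Huv =
      ≤-trans (s≤s z≤n) (m≤n+m _ ([ P? u ] * [ u Fin.≟ v ]))
    ... | inj₂ p rewrite []-yes (h v ≤? 3) p | []-yes (H? v u) (H-sym Huv) =
      ≤-trans (m≤n+m 1 (g u v)) (m≤n+m _ ([ P? u ] * [ u Fin.≟ v ]))

-- Copies and hexagons

∈-tabulate⇔ : ∀ {n} {P : Fin n → Set} (P? : Decidable P) v →
  v Subset.∈ Vec.tabulate (does ∘ P?) ⇔ P v
∈-tabulate⇔ {P = P} P? v = mk⇔
  (λ v∈ → holds (P? v) (trans (sym (lookup∘tabulate (does ∘ P?) v)) ([]=⇒lookup v∈)))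
  (λ Pv → lookup⇒[]= v _ (trans (lookup∘tabulate (does ∘ P?) v) (dec-true (P? v) Pv)))
  where
  holds : (p? : Dec (P v)) → does p? ≡ true → P v
  holds (yes p) _  = p
  holds (no _)  ()

matrix : ∀ {n} {P : Fin n → Fin n → Set} → (∀ u → Decidable (P u)) → Vec (Subset.Subset n) n
matrix P? = Vec.tabulate λ u → Vec.tabulate (does ∘ P? u)

∈-matrix⇔ : ∀ {n} {P : Fin n → Fin n → Set} (P? : ∀ u → Decidable (P u)) u v →
  v Subset.∈ Vec.lookup (matrix P?) u ⇔ P u v
∈-matrix⇔ {P = P} P? u v = subst (λ N → v Subset.∈ N ⇔ P u v)
  (sym (lookup∘tabulate (λ u → Vec.tabulate (does ∘ P? u)) u)) (∈-tabulate⇔ (P? u) v)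

module _ {k n} (F : Graph k) (f : Fin k → Fin n) where
  private module F = Graph F

  Arc : Fin n → Fin n → Set
  Arc u v = ∃[ i ] ∃[ j ] (f i ≡ u × f j ≡ v × i F.~ j)

  arc? : ∀ u v → Dec (Arc u v)
  arc? u v = Fin.any? λ i → Fin.any? λ j →
    (f i Fin.≟ u) ×-dec (f j Fin.≟ v) ×-dec (j Subset.∈? Vec.lookup F.nbhd i)

  image : VE n
  image = ve (Vec.tabulate λ v → does (Fin.any? λ i → f i Fin.≟ v)) (matrix arc?)

  image-~ : ∀ u v → VE._~_ image u v ⇔ Arc u v
  image-~ = ∈-matrix⇔ arc?

  image-isIso : Injective _≡_ _≡_ f →
    (∀ v → v Subset.∈ VE.verts image ⇔ (∃[ i ] f i ≡ v)) × (∀ i j → i F.~ j ⇔ VE._~_ image (f i) (f j))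
  image-isIso inj = ∈-tabulate⇔ (λ v → Fin.any? λ i → f i Fin.≟ v) , λ i j → mk⇔
    (λ i~j → Equivalence.from (image-~ (f i) (f j)) (i , j , refl , refl , i~j))
    (λ fi~fj → back (Equivalence.to (image-~ (f i) (f j)) fi~fj))
    where
    back : ∀ {i j} → Arc (f i) (f j) → i F.~ j
    back (i′ , j′ , ei , ej , i~j) = subst₂ F._~_ (inj ei) (inj ej) i~j

  image-⊑ : (G : Graph n) → (∀ {i j} → i F.~ j → Graph._~_ G (f i) (f j)) → image ⊑ G
  image-⊑ G hom =
      (λ u v u~v → let (i , j , ei , ej , i~j) = Equivalence.to (image-~ u v) u~v in
        Equivalence.from (image-~ v u) (j , i , ej , ei , F.~-sym i j i~j))
    , (λ u v u~v → let (i , _ , ei , _) = Equivalence.to (image-~ u v) u~v in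
        Equivalence.from (∈-tabulate⇔ (λ v → Fin.any? λ i → f i Fin.≟ v) u) (i , ei))
    , (λ u v u~v → let (i , j , ei , ej , i~j) = Equivalence.to (image-~ u v) u~v in
        subst₂ (Graph._~_ G) ei ej (hom i~j))

  -- An injective homomorphism suffices, since the image carries only the arcs of `F` and not all
  -- arcs of `G` between its vertices.
  image-isCopy : (G : Graph n) → Injective _≡_ _≡_ f →
    (∀ {i j} → i F.~ j → Graph._~_ G (f i) (f j)) → IsCopy F G image
  image-isCopy G inj hom = image-⊑ G hom , f , inj , image-isIso inj

cycle~? : ∀ k i j → Dec (j Subset.∈ Vec.lookup (cycleNbhd k) i)
cycle~? k i j = j Subset.∈? Vec.lookup (cycleNbhd k) i

module _ {n} (G : Graph n) (bip : Bipartite G) (C₈-free : Free (Cycle 8) G) where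
  open Graph G
  private
    X : Subset.Subset n
    X = proj₁ bip

  -- The form in which C₈-freeness is applied: distinctness is checked only within the p's and
  -- within the q's, since bipartiteness keeps the two families apart.
  no-C₈ : ∀ {p₀ p₁ p₂ p₃ q₀ q₁ q₂ q₃} →
    Unique (p₀ ∷ p₁ ∷ p₂ ∷ p₃ ∷ []) → Unique (q₀ ∷ q₁ ∷ q₂ ∷ q₃ ∷ []) →
    p₀ ~ q₀ → q₀ ~ p₁ → p₁ ~ q₁ → q₁ ~ p₂ → p₂ ~ q₂ → q₂ ~ p₃ → p₃ ~ q₃ → q₃ ~ p₀ → ⊥
  no-C₈ {p₀} {p₁} {p₂} {p₃} {q₀} {q₁} {q₂} {q₃} ps! qs! e₀ e₁ e₂ e₃ e₄ e₅ e₆ e₇ =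
    C₈-free (image (Cycle 8) f , image-isCopy (Cycle 8) f G f-inj (λ {i} {j} → f-hom i j))
    where
    ps qs : List (Fin n)
    ps = p₀ ∷ p₁ ∷ p₂ ∷ p₃ ∷ []
    qs = q₀ ∷ q₁ ∷ q₂ ∷ q₃ ∷ []

    SameSide : Fin n → Fin n → Set
    SameSide u v = (u Subset.∈ X × v Subset.∈ X) ⊎ (u Subset.∉ X × v Subset.∉ X)

    ~-sides : ∀ {u v} → u ~ v → ¬ SameSide u v
    ~-sides {u} {v} u~v s with proj₂ bip u v u~v | s
    ... | inj₁ (_ , v∉) | inj₁ (_ , v∈) = v∉ v∈
    ... | inj₁ (u∈ , _) | inj₂ (u∉ , _) = u∉ u∈
    ... | inj₂ (u∉ , _) | inj₁ (u∈ , _) = u∉ u∈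
    ... | inj₂ (_ , v∈) | inj₂ (_ , v∉) = v∉ v∈

    hop : ∀ {u v w} → u ~ v → v ~ w → SameSide u w
    hop {u} {v} {w} u~v v~w with proj₂ bip u v u~v | proj₂ bip v w v~w
    ... | inj₁ (u∈ , v∉) | inj₁ (v∈ , _)  = contradiction v∈ v∉
    ... | inj₁ (u∈ , v∉) | inj₂ (_ , w∈)  = inj₁ (u∈ , w∈)
    ... | inj₂ (u∉ , v∈) | inj₁ (_ , w∉)  = inj₂ (u∉ , w∉)
    ... | inj₂ (u∉ , v∈) | inj₂ (v∉ , _)  = contradiction v∈ v∉

    SameSide-trans : ∀ {u v w} → SameSide u v → SameSide v w → SameSide u w
    SameSide-trans (inj₁ (u∈ , _))  (inj₁ (_ , w∈)) = inj₁ (u∈ , w∈)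
    SameSide-trans (inj₁ (_ , v∈))  (inj₂ (v∉ , _)) = contradiction v∈ v∉
    SameSide-trans (inj₂ (_ , v∉))  (inj₁ (v∈ , _)) = contradiction v∈ v∉
    SameSide-trans (inj₂ (u∉ , _))  (inj₂ (_ , w∉)) = inj₂ (u∉ , w∉)

    SameSide-sym : ∀ {u v} → SameSide u v → SameSide v u
    SameSide-sym (inj₁ (u∈ , v∈)) = inj₁ (v∈ , u∈)
    SameSide-sym (inj₂ (u∉ , v∉)) = inj₂ (v∉ , u∉)

    p-sides : All (SameSide p₀) ps
    p-sides = SameSide-trans (hop e₀ e₁) (SameSide-sym (hop e₀ e₁)) ∷ hop e₀ e₁
      ∷ SameSide-trans (hop e₀ e₁) (hop e₂ e₃) ∷ SameSide-sym (hop e₆ e₇) ∷ []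

    q-sides : All (SameSide q₀) qs
    q-sides = SameSide-trans (hop e₁ e₂) (SameSide-sym (hop e₁ e₂)) ∷ hop e₁ e₂
      ∷ SameSide-trans (hop e₁ e₂) (hop e₃ e₄) ∷ SameSide-sym (hop e₇ e₀) ∷ []

    disjoint : ∀ {v} → ¬ (v ∈ ps × v ∈ qs)
    disjoint (v∈ps , v∈qs) = ~-sides e₀
      (SameSide-trans (All.lookup p-sides v∈ps) (SameSide-sym (All.lookup q-sides v∈qs)))

    -- Interleaves `ps ++ qs` into the cyclic order p₀ q₀ p₁ q₁ p₂ q₂ p₃ q₃.
    σ : Fin 8 → Fin 8
    σ = Vec.lookup (0F ∷ 4F ∷ 1F ∷ 5F ∷ 2F ∷ 6F ∷ 3F ∷ 7F ∷ [])

    σ-inj : ∀ i j → σ i ≡ σ j → i ≡ j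
    -- A finite statement, settled by evaluating its decision procedure; `from-yes` plays this role
    -- throughout.
    σ-inj = from-yes (all₂? λ i j → (σ i Fin.≟ σ j) →-dec (i Fin.≟ j))

    f : Fin 8 → Fin n
    f i = List.lookup (ps ++ qs) (σ i)

    f-inj : Injective _≡_ _≡_ f
    f-inj {i} {j} e = σ-inj i j (lookup-injective (Unique.++⁺ ps! qs! disjoint) (σ i) (σ j) e)

    next : Fin 8 → Fin 8
    next = Vec.lookup (1F ∷ 2F ∷ 3F ∷ 4F ∷ 5F ∷ 6F ∷ 7F ∷ 0F ∷ [])

    ~-next : ∀ i j → j Subset.∈ Vec.lookup (cycleNbhd 8) i → j ≡ next i ⊎ i ≡ next j
    ~-next = from-yes (all₂? λ i j → cycle~? 8 i j →-dec ((j Fin.≟ next i) ⊎-dec (i Fin.≟ next j)))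

    step : ∀ i → f i ~ f (next i)
    step 0F = e₀
    step 1F = e₁
    step 2F = e₂
    step 3F = e₃
    step 4F = e₄
    step 5F = e₅
    step 6F = e₆
    step 7F = e₇

    f-hom : ∀ i j → Graph._~_ (Cycle 8) i j → f i ~ f j
    f-hom i j i~j with ~-next i j i~j
    ... | inj₁ refl = step i
    ... | inj₂ refl = ~-sym _ _ (step j)

-- `odd i` is antipodal to `even i` on the six-cycle, so that `even i` and `odd j` are adjacent
-- exactly when i ≠ j.
even odd : Fin 3 → Fin 6
even = Vec.lookup (0F ∷ 2F ∷ 4F ∷ [])
odd  = Vec.lookup (3F ∷ 5F ∷ 1F ∷ [])

-- The six-cycle x₀ y₂ x₁ y₀ x₂ y₁, seen as K₃,₃ minus a perfect matching: xᵢ is opposite to yᵢ.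
record Hexagon {n} (G : Graph n) (S : VE n) (x y : Fin 3 → Fin n) : Set where
  open Graph G using (_~_)
  field
    x-inj : Injective _≡_ _≡_ x
    y-inj : Injective _≡_ _≡_ y
    x~y   : ∀ {i j} → i ≢ j → x i ~ y j
    arcs  : ∀ u v → VE._~_ S u v ⇔ (∃[ i ] ∃[ j ] (i ≢ j × ((u ≡ x i × v ≡ y j) ⊎ (u ≡ y j × v ≡ x i))))
    verts : ∀ v → v Subset.∈ VE.verts S ⇔ (∃[ i ] (v ≡ x i ⊎ v ≡ y i))

isIso⇒hexagon : ∀ {n} {G : Graph n} {S} → S ⊑ G → (f : Fin 6 → Fin n) → Injective _≡_ _≡_ f →
  (∀ v → v Subset.∈ VE.verts S ⇔ (∃[ i ] f i ≡ v)) →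
  (∀ i j → Graph._~_ (Cycle 6) i j ⇔ VE._~_ S (f i) (f j)) →
  Hexagon G S (f ∘ even) (f ∘ odd)
isIso⇒hexagon {n} {G} {S} (S-sym , S-vert , S⊆G) f f-inj im adj = record
  { x-inj = λ {i} {j} e → even-inj i j (f-inj e)
  ; y-inj = λ {i} {j} e → odd-inj i j (f-inj e)
  ; x~y   = λ i≢j → S⊆G _ _ (S-x~y i≢j)
  ; arcs  = λ u v → mk⇔ (to u v) from
  ; verts = λ v → mk⇔
      (λ v∈ → vert (Equivalence.to (im v) v∈))
      λ { (i , inj₁ refl) → Equivalence.from (im _) (even i , refl)
        ; (i , inj₂ refl) → Equivalence.from (im _) (odd i , refl) }
  }
  where
  module S = VE S

  even-inj : ∀ i j → even i ≡ even j → i ≡ j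
  even-inj = from-yes (all₂? λ i j → (even i Fin.≟ even j) →-dec (i Fin.≟ j))
  odd-inj : ∀ i j → odd i ≡ odd j → i ≡ j
  odd-inj = from-yes (all₂? λ i j → (odd i Fin.≟ odd j) →-dec (i Fin.≟ j))

  even~odd : ∀ i j → i ≢ j → odd j Subset.∈ Vec.lookup (cycleNbhd 6) (even i)
  even~odd = from-yes (all₂? λ i j → ¬? (i Fin.≟ j) →-dec cycle~? 6 (even i) (odd j))

  S-x~y : ∀ {i j} → i ≢ j → f (even i) S.~ f (odd j)
  S-x~y {i} {j} i≢j = Equivalence.to (adj (even i) (odd j)) (even~odd i j i≢j)

  cover : ∀ p → ∃[ i ] (p ≡ even i ⊎ p ≡ odd i)
  cover = from-yes (Fin.all? λ p → Fin.any? λ i → (p Fin.≟ even i) ⊎-dec (p Fin.≟ odd i))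

  ~-cover : ∀ p q → q Subset.∈ Vec.lookup (cycleNbhd 6) p →
    ∃[ i ] ∃[ j ] (i ≢ j × ((p ≡ even i × q ≡ odd j) ⊎ (p ≡ odd j × q ≡ even i)))
  ~-cover = from-yes (all₂? λ p q → cycle~? 6 p q →-dec Fin.any? λ i → Fin.any? λ j → ¬? (i Fin.≟ j) ×-dec
    (((p Fin.≟ even i) ×-dec (q Fin.≟ odd j)) ⊎-dec ((p Fin.≟ odd j) ×-dec (q Fin.≟ even i))))

  vert : ∀ {v} → ∃[ p ] f p ≡ v → ∃[ i ] (v ≡ f (even i) ⊎ v ≡ f (odd i))
  vert (p , refl) with cover p
  ... | i , inj₁ refl = i , inj₁ refl
  ... | i , inj₂ refl = i , inj₂ refl

  HexArc : Fin n → Fin n → Set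
  HexArc u v = ∃[ i ] ∃[ j ] (i ≢ j × ((u ≡ f (even i) × v ≡ f (odd j)) ⊎ (u ≡ f (odd j) × v ≡ f (even i))))

  to : ∀ u v → u S.~ v → HexArc u v
  to u v u~v with Equivalence.to (im u) (S-vert u v u~v) | Equivalence.to (im v) (S-vert v u (S-sym u v u~v))
  ... | p , refl | q , refl with ~-cover p q (Equivalence.from (adj p q) u~v)
  ... | i , j , i≢j , inj₁ (refl , refl) = i , j , i≢j , inj₁ (refl , refl)
  ... | i , j , i≢j , inj₂ (refl , refl) = i , j , i≢j , inj₂ (refl , refl)

  from : ∀ {u v} → HexArc u v → u S.~ v
  from (i , j , i≢j , inj₁ (refl , refl)) = S-x~y i≢j
  from (i , j , i≢j , inj₂ (refl , refl)) = S-sym _ _ (S-x~y i≢j)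

-- Fat pairs

lookup-ext : ∀ {A : Set} {k} {v w : Vec A k} → (∀ i → Vec.lookup v i ≡ Vec.lookup w i) → v ≡ w
lookup-ext {v = []}    {[]}    e = refl
lookup-ext {v = a ∷ v} {b ∷ w} e = cong₂ _∷_ (e zero) (lookup-ext (e ∘ suc))

subset-ext : ∀ {n} {A B : Subset.Subset n} → (∀ v → v Subset.∈ A ⇔ v Subset.∈ B) → A ≡ B
subset-ext A⇔B = Subset.⊆-antisym (λ {v} → Equivalence.to (A⇔B v)) (λ {v} → Equivalence.from (A⇔B v))

module _ {n} {G : Graph n} where

  -- `verts` and `arcs` describe the subgraph by its labels alone, and `VE` carries no proofs, so
  -- extensionality yields an equality.
  hexagon-unique : ∀ {S S′ x x′ y y′} → Hexagon G S x y → Hexagon G S′ x′ y′ →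
    x ≗ x′ → y ≗ y′ → S ≡ S′
  hexagon-unique {S} {S′} H H′ x≗ y≗ = cong₂ ve
    (subset-ext λ v → mk⇔
      (λ v∈ → Equivalence.from (H′.verts v) (vert x≗ y≗ (Equivalence.to (H.verts v) v∈)))
      (λ v∈ → Equivalence.from (H.verts v) (vert (sym ∘ x≗) (sym ∘ y≗) (Equivalence.to (H′.verts v) v∈))))
    (lookup-ext λ u → subset-ext λ v → mk⇔
      (λ u~v → Equivalence.from (H′.arcs u v) (arc x≗ y≗ (Equivalence.to (H.arcs u v) u~v)))
      (λ u~v → Equivalence.from (H.arcs u v) (arc (sym ∘ x≗) (sym ∘ y≗) (Equivalence.to (H′.arcs u v) u~v))))
    where
    module H = Hexagon H
    module H′ = Hexagon H′

    vert : ∀ {x x′ y y′ : Fin 3 → Fin n} {v} → x ≗ x′ → y ≗ y′ →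
      ∃[ i ] (v ≡ x i ⊎ v ≡ y i) → ∃[ i ] (v ≡ x′ i ⊎ v ≡ y′ i)
    vert x≗ y≗ (i , inj₁ refl) = i , inj₁ (x≗ i)
    vert x≗ y≗ (i , inj₂ refl) = i , inj₂ (y≗ i)

    arc : ∀ {x x′ y y′ : Fin 3 → Fin n} {u v} → x ≗ x′ → y ≗ y′ →
      ∃[ i ] ∃[ j ] (i ≢ j × ((u ≡ x i × v ≡ y j) ⊎ (u ≡ y j × v ≡ x i))) →
      ∃[ i ] ∃[ j ] (i ≢ j × ((u ≡ x′ i × v ≡ y′ j) ⊎ (u ≡ y′ j × v ≡ x′ i)))
    arc x≗ y≗ (i , j , i≢j , inj₁ (refl , refl)) = i , j , i≢j , inj₁ (x≗ i , y≗ j)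
    arc x≗ y≗ (i , j , i≢j , inj₂ (refl , refl)) = i , j , i≢j , inj₂ (y≗ j , x≗ i)

  hexagon-swap : ∀ {S x y} → Hexagon G S x y → Hexagon G S y x
  hexagon-swap {S} {x} {y} H = record
    { x-inj = y-inj
    ; y-inj = x-inj
    ; x~y   = λ i≢j → Graph.~-sym G _ _ (x~y (i≢j ∘ sym))
    ; arcs  = λ u v → mk⇔ (turn ∘ Equivalence.to (arcs u v)) (Equivalence.from (arcs u v) ∘ turn)
    ; verts = λ v → mk⇔ (flip-side ∘ Equivalence.to (verts v)) (Equivalence.from (verts v) ∘ flip-side)
    }
    where
    open Hexagon H
    turn : ∀ {x y : Fin 3 → Fin n} {u v} →
      ∃[ i ] ∃[ j ] (i ≢ j × ((u ≡ x i × v ≡ y j) ⊎ (u ≡ y j × v ≡ x i))) →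
      ∃[ i ] ∃[ j ] (i ≢ j × ((u ≡ y i × v ≡ x j) ⊎ (u ≡ x j × v ≡ y i)))
    turn (i , j , i≢j , inj₁ e) = j , i , i≢j ∘ sym , inj₂ e
    turn (i , j , i≢j , inj₂ e) = j , i , i≢j ∘ sym , inj₁ e

    flip-side : ∀ {x y : Fin 3 → Fin n} {v} → ∃[ i ] (v ≡ x i ⊎ v ≡ y i) → ∃[ i ] (v ≡ y i ⊎ v ≡ x i)
    flip-side (i , inj₁ e) = i , inj₂ e
    flip-side (i , inj₂ e) = i , inj₁ e

  -- Permuting both sides simultaneously keeps xᵢ opposite to yᵢ. Together with the exchange of
  -- sides this gives all twelve symmetries of C₆, hence every choice of labels made below without
  -- loss of generality.
  hexagon-permute : ∀ {S x y} (π : Permutation′ 3) → Hexagon G S x y →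
    Hexagon G S (x ∘ (π ⟨$⟩ʳ_)) (y ∘ (π ⟨$⟩ʳ_))
  hexagon-permute {S} {x} {y} π H = record
    { x-inj = π-inj ∘ x-inj
    ; y-inj = π-inj ∘ y-inj
    ; x~y   = λ i≢j → x~y (i≢j ∘ π-inj)
    ; arcs  = λ u v → mk⇔ (pull ∘ Equivalence.to (arcs u v)) (Equivalence.from (arcs u v) ∘ push)
    ; verts = λ v → mk⇔
        (λ v∈ → pull-vert (Equivalence.to (verts v) v∈))
        (λ (i , e) → Equivalence.from (verts v) (π ⟨$⟩ʳ i , e))
    }
    where
    open Hexagon H
    π-inj : ∀ {i j} → π ⟨$⟩ʳ i ≡ π ⟨$⟩ʳ j → i ≡ j
    π-inj e = trans (sym (inverseˡ π)) (trans (cong (π ⟨$⟩ˡ_) e) (inverseˡ π))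

    at : ∀ (z : Fin 3 → Fin n) {v i} → v ≡ z i → v ≡ z (π ⟨$⟩ʳ (π ⟨$⟩ˡ i))
    at z e = trans e (cong z (sym (inverseʳ π)))

    pull-vert : ∀ {v} → ∃[ i ] (v ≡ x i ⊎ v ≡ y i) → ∃[ i ] (v ≡ x (π ⟨$⟩ʳ i) ⊎ v ≡ y (π ⟨$⟩ʳ i))
    pull-vert (i , inj₁ e) = π ⟨$⟩ˡ i , inj₁ (at x e)
    pull-vert (i , inj₂ e) = π ⟨$⟩ˡ i , inj₂ (at y e)

    push : ∀ {u v} →
      ∃[ i ] ∃[ j ] (i ≢ j × ((u ≡ x (π ⟨$⟩ʳ i) × v ≡ y (π ⟨$⟩ʳ j)) ⊎ (u ≡ y (π ⟨$⟩ʳ j) × v ≡ x (π ⟨$⟩ʳ i)))) →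
      ∃[ i ] ∃[ j ] (i ≢ j × ((u ≡ x i × v ≡ y j) ⊎ (u ≡ y j × v ≡ x i)))
    push (i , j , i≢j , e) = π ⟨$⟩ʳ i , π ⟨$⟩ʳ j , i≢j ∘ π-inj , e

    pull : ∀ {u v} →
      ∃[ i ] ∃[ j ] (i ≢ j × ((u ≡ x i × v ≡ y j) ⊎ (u ≡ y j × v ≡ x i))) →
      ∃[ i ] ∃[ j ] (i ≢ j × ((u ≡ x (π ⟨$⟩ʳ i) × v ≡ y (π ⟨$⟩ʳ j)) ⊎ (u ≡ y (π ⟨$⟩ʳ j) × v ≡ x (π ⟨$⟩ʳ i))))
    pull (i , j , i≢j , e) = π ⟨$⟩ˡ i , π ⟨$⟩ˡ j , π⁻¹i≢π⁻¹j , both e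
      where
      π⁻¹i≢π⁻¹j : π ⟨$⟩ˡ i ≢ π ⟨$⟩ˡ j
      π⁻¹i≢π⁻¹j e′ = i≢j (trans (sym (inverseʳ π)) (trans (cong (π ⟨$⟩ʳ_) e′) (inverseʳ π)))
      both : ∀ {u v} → (u ≡ x i × v ≡ y j) ⊎ (u ≡ y j × v ≡ x i) → _
      both (inj₁ (p , q)) = inj₁ (at x p , at y q)
      both (inj₂ (p , q)) = inj₂ (at y p , at x q)

-- Sorted labels

Sorted : ∀ {n} → (Fin 3 → Fin n) → Set
Sorted x = ∀ i j → i Fin.< j → x i Fin.< x j

sorted₃ : ∀ {n} {x : Fin 3 → Fin n} → x 0F Fin.< x 1F → x 1F Fin.< x 2F → Sorted x
sorted₃ p q 0F 0F ()
sorted₃ p q 0F 1F _ = p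
sorted₃ p q 0F 2F _ = <-trans p q
sorted₃ p q 1F 0F ()
sorted₃ p q 1F 1F (s≤s ())
sorted₃ p q 1F 2F _ = q
sorted₃ p q 2F 0F ()
sorted₃ p q 2F 1F (s≤s ())
sorted₃ p q 2F 2F (s≤s (s≤s ()))

rotate : Permutation′ 3
rotate = permutation to from
  (from-yes (Fin.all? λ i → to (from i) Fin.≟ i)) (from-yes (Fin.all? λ i → from (to i) Fin.≟ i))
  where
  to from : Fin 3 → Fin 3
  to   = Vec.lookup (1F ∷ 2F ∷ 0F ∷ [])
  from = Vec.lookup (2F ∷ 0F ∷ 1F ∷ [])

sort : ∀ {n} (x : Fin 3 → Fin n) → Injective _≡_ _≡_ x → ∃[ π ] Sorted (x ∘ (π ⟨$⟩ʳ_))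
sort x inj with Fin.<-cmp (x 0F) (x 1F) | Fin.<-cmp (x 1F) (x 2F) | Fin.<-cmp (x 0F) (x 2F)
... | tri≈ _ e _ | _          | _          = contradiction (inj e) λ ()
... | tri< _ _ _ | tri≈ _ e _ | _          = contradiction (inj e) λ ()
... | tri> _ _ _ | tri≈ _ e _ | _          = contradiction (inj e) λ ()
... | tri< _ _ _ | tri> _ _ _ | tri≈ _ e _ = contradiction (inj e) λ ()
... | tri> _ _ _ | tri< _ _ _ | tri≈ _ e _ = contradiction (inj e) λ ()
... | tri< p _ _ | tri< q _ _ | _          = idₚ , sorted₃ p q
... | tri< _ _ _ | tri> _ _ q | tri< r _ _ = transpose 1F 2F , sorted₃ r q
... | tri< p _ _ | tri> _ _ _ | tri> _ _ r = flip rotate , sorted₃ r p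
... | tri> _ _ p | tri< _ _ _ | tri< r _ _ = transpose 0F 1F , sorted₃ p r
... | tri> _ _ _ | tri< q _ _ | tri> _ _ r = rotate , sorted₃ q r
... | tri> _ _ p | tri> _ _ q | _          = transpose 0F 2F , sorted₃ q p

-- `x′` is `x` reindexed by a strictly increasing map from `Fin 3` to itself, hence by the identity.
sorted-unique : ∀ {n} {x x′ : Fin 3 → Fin n} → Sorted x → Sorted x′ →
  (∀ k → ∃[ l ] x′ k ≡ x l) → x ≗ x′
sorted-unique {x = x} {x′} sx sx′ x′⊆x k = sym (trans (proj₂ (x′⊆x k)) (cong x (increasing⇒id k)))
  where
  l : Fin 3 → Fin 3
  l = proj₁ ∘ x′⊆x

  reflects : ∀ a b → x a Fin.< x b → a Fin.< b
  reflects a b xa<xb with Fin.<-cmp a b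
  ... | tri< a<b _ _  = a<b
  ... | tri≈ _ refl _ = contradiction xa<xb (<-irrefl refl)
  ... | tri> _ _ b<a  = contradiction xa<xb (<-asym (sx b a b<a))

  l-mono : ∀ i j → i Fin.< j → l i Fin.< l j
  l-mono i j i<j = reflects (l i) (l j) (subst₂ Fin._<_ (proj₂ (x′⊆x i)) (proj₂ (x′⊆x j)) (sx′ i j i<j))

  table : ∀ a b c → a Fin.< b → b Fin.< c → a ≡ 0F × b ≡ 1F × c ≡ 2F
  table = from-yes (Fin.all? {3} λ a → Fin.all? {3} λ b → Fin.all? {3} λ c →
    (a Fin.<? b) →-dec (b Fin.<? c) →-dec ((a Fin.≟ 0F) ×-dec (b Fin.≟ 1F) ×-dec (c Fin.≟ 2F)))

  increasing⇒id : ∀ k → l k ≡ k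
  increasing⇒id k with table (l 0F) (l 1F) (l 2F) (l-mono 0F 1F (s≤s z≤n)) (l-mono 1F 2F (s≤s (s≤s z≤n))) | k
  ... | e , _ , _ | 0F = e
  ... | _ , e , _ | 1F = e
  ... | _ , _ , e | 2F = e

others : ∀ (k : Fin 3) → ∃[ i ] ∃[ j ] (i ≢ j × i ≢ k × j ≢ k)
others = from-yes (Fin.all? {3} λ k → Fin.any? λ i → Fin.any? λ j →
  ¬? (i Fin.≟ j) ×-dec ¬? (i Fin.≟ k) ×-dec ¬? (j Fin.≟ k))

distinct₄ : ∀ {A : Set} {a b c d : A} →
  a ≢ b → a ≢ c → a ≢ d → b ≢ c → b ≢ d → c ≢ d → Unique (a ∷ b ∷ c ∷ d ∷ [])
distinct₄ ab ac ad bc bd cd = (ab ∷ ac ∷ ad ∷ []) ∷ (bc ∷ bd ∷ []) ∷ (cd ∷ []) ∷ [] ∷ []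

-- Common neighbours, fat pairs and the degree sum

module _ {n} (G : Graph n) where
  open Graph G

  nbr? : ∀ u → Decidable (u ~_)
  nbr? u w = w Subset.∈? Vec.lookup nbhd u

  Common : Fin n → Fin n → Fin n → Set
  Common u v w = u ~ w × v ~ w

  common? : ∀ u v → Decidable (Common u v)
  common? u v w = nbr? u w ×-dec nbr? v w

  degree : Fin n → ℕ
  degree u = # (nbr? u)

  codegree : Fin n → Fin n → ℕ
  codegree u v = # (common? u v)

  -- Four, because each eight-cycle built below asks a common neighbour to avoid at most three
  -- vertices.
  Fat : Fin n → Fin n → Set
  Fat u v = 4 ≤ codegree u v

  fat? : ∀ u v → Dec (Fat u v)
  fat? u v = 4 ≤? codegree u v

  Fat-sym : ∀ {u v} → Fat u v → Fat v u
  Fat-sym {u} {v} = subst (4 ≤_) (trans (#-∑ (common? u v)) (trans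
    (sum-cong-≗ λ w → []-⇔ (common? u v w) (common? v u w) (λ (a , b) → b , a) (λ (a , b) → b , a))
    (sym (#-∑ (common? v u)))))

  AllFat : (Fin 3 → Fin n) → Set
  AllFat x = ∀ i j → i ≢ j → Fat (x i) (x j)

  fat-fresh : ∀ {u v} → Fat u v → ∀ ys → length ys < 4 → ∃[ w ] u ~ w × w ~ v × w ∉ ys
  fat-fresh {u} {v} fat ys ys<4 =
    let (w , (u~w , v~w) , w∉) = #-fresh (common? u v) ys (≤-trans ys<4 fat) in w , u~w , ~-sym v w v~w , w∉

module _ {n} (G : Graph n) (bip : Bipartite G) (C₈-free : Free (Cycle 8) G) where
  open Graph G

  FatCherry : Fin n → Fin n → Fin n → Set
  FatCherry w u v = (w ~ u × w ~ v) × Fat G u v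

  fatCherry? : ∀ w u → Decidable (FatCherry w u)
  fatCherry? w u v = (nbr? G w u ×-dec nbr? G w v) ×-dec fat? G u v

  -- New common neighbours of the three fat pairs turn x u v z into a path x m₁ u m₂ v m₃ z, which
  -- `w` closes to an eight-cycle.
  fatCherry-P₄-free : ∀ w {x u v z} → Unique (x ∷ u ∷ v ∷ z ∷ []) →
    FatCherry w x u → FatCherry w u v → FatCherry w v z → ⊥
  fatCherry-P₄-free w ps! ((w~x , _) , xu) (_ , uv) ((_ , w~z) , vz) =
    let (m₁ , a₁ , b₁ , m₁∉) = fat-fresh G xu (w ∷ []) (s≤s (s≤s z≤n))
        (m₂ , a₂ , b₂ , m₂∉) = fat-fresh G uv (w ∷ m₁ ∷ []) (s≤s (s≤s (s≤s z≤n)))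
        (m₃ , a₃ , b₃ , m₃∉) = fat-fresh G vz (w ∷ m₁ ∷ m₂ ∷ []) ≤-refl
    in no-C₈ G bip C₈-free ps!
      (distinct₄ (m₂∉ ∘ there ∘ here ∘ sym) (m₃∉ ∘ there ∘ here ∘ sym) (m₁∉ ∘ here)
        (m₃∉ ∘ there ∘ there ∘ here ∘ sym) (m₂∉ ∘ here) (m₃∉ ∘ here))
      a₁ b₁ a₂ b₂ a₃ b₃ (~-sym _ _ w~z) w~x

  private
    m : ℕ
    m = ∑[ w < n ] degree G w

  -- A light pair has at most three common neighbours; for a fat pair, every common neighbour is the
  -- centre of a fat cherry.
  codegree≤ : ∀ u v → codegree G u v ≤ 3 + ∑[ w < n ] [ fatCherry? w u v ]
  codegree≤ u v = go (fat? G u v)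
    where
    go : Dec (Fat G u v) → codegree G u v ≤ 3 + ∑[ w < n ] [ fatCherry? w u v ]
    go (no ¬fat) = ≤-trans (≤-pred (≰⇒> ¬fat)) (m≤m+n 3 _)
    go (yes fat) = ≤-trans
      (≤-reflexive (#-∑ (common? G u v)))
      (≤-trans
        (∑-mono λ w → []≤ (common? G u v w) λ (u~w , v~w) →
          ≤-reflexive (sym ([]-yes (fatCherry? w u v) ((~-sym _ _ u~w , ~-sym _ _ v~w) , fat))))
        (m≤n+m _ 3))

  -- Both sides count the triples with `w` adjacent to `u` and to `v`, grouped by `w` on the left
  -- and by the pair on the right.
  ∑degree² : ∑[ w < n ] (degree G w * degree G w) ≡ ∑[ u < n ] ∑[ v < n ] codegree G u v
  ∑degree² = begin
    ∑[ w < n ] (degree G w * degree G w)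
      ≡⟨ sum-cong-≗ {n} (λ w → trans (cong (_* degree G w) (#-∑ (nbr? G w)))
           (trans (*-distribʳ-sum (degree G w) (λ u → [ nbr? G w u ])) (sum-cong-≗ {n} (λ u →
             trans (cong ([ nbr? G w u ] *_) (#-∑ (nbr? G w)))
               (trans (*-distribˡ-sum [ nbr? G w u ] (λ v → [ nbr? G w v ])) (sum-cong-≗ {n} (cell w u))))))) ⟩
    ∑[ w < n ] ∑[ u < n ] ∑[ v < n ] [ common? G u v w ]
      ≡⟨ ∑-comm (λ w u → ∑[ v < n ] [ common? G u v w ]) ⟩
    ∑[ u < n ] ∑[ w < n ] ∑[ v < n ] [ common? G u v w ]
      ≡⟨ sum-cong-≗ {n} (λ u → trans (∑-comm (λ w v → [ common? G u v w ]))
           (sum-cong-≗ {n} (λ v → sym (#-∑ (common? G u v))))) ⟩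
    ∑[ u < n ] ∑[ v < n ] codegree G u v ∎
    where
    open ≡-Reasoning
    product : ∀ {P Q : Set} (p? : Dec P) (q? : Dec Q) → [ p? ] * [ q? ] ≡ [ p? ×-dec q? ]
    product (yes _) (yes _) = refl
    product (yes _) (no _)  = refl
    product (no _)  _       = refl

    cell : ∀ w u v → [ nbr? G w u ] * [ nbr? G w v ] ≡ [ common? G u v w ]
    cell w u v = trans
      (cong₂ _*_ ([]-⇔ (nbr? G w u) (nbr? G u w) (~-sym w u) (~-sym u w))
                 ([]-⇔ (nbr? G w v) (nbr? G v w) (~-sym w v) (~-sym v w)))
      (product (nbr? G u w) (nbr? G v w))

  -- Light pairs contribute at most three each. The fat pairs are counted by centre: those inside
  -- the neighbourhood of `w` contain no path on four vertices, so there are at most seven times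
  -- `degree G w` of them, as ordered pairs.
  ∑codegree≤ : ∑[ u < n ] ∑[ v < n ] codegree G u v ≤ n * (n * 3) + 7 * m
  ∑codegree≤ = begin
    ∑[ u < n ] ∑[ v < n ] codegree G u v
      ≤⟨ ∑-mono {n} (λ u → ∑-mono {n} (λ v → codegree≤ u v)) ⟩
    ∑[ u < n ] ∑[ v < n ] (3 + ∑[ w < n ] c w u v)
      ≡⟨ sum-cong-≗ {n} (λ u → trans (∑-distrib-+ {n} (λ _ → 3) (λ v → ∑[ w < n ] c w u v))
           (cong₂ _+_ (∑-const n 3) (∑-comm (λ v w → c w u v)))) ⟩
    ∑[ u < n ] (n * 3 + ∑[ w < n ] ∑[ v < n ] c w u v)
      ≡⟨ trans (∑-distrib-+ {n} (λ _ → n * 3) (λ u → ∑[ w < n ] ∑[ v < n ] c w u v))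
           (cong₂ _+_ (∑-const n (n * 3)) (∑-comm (λ u w → ∑[ v < n ] c w u v))) ⟩
    n * (n * 3) + ∑[ w < n ] ∑[ u < n ] ∑[ v < n ] c w u v
      ≡⟨ cong (n * (n * 3) +_) (sum-cong-≗ {n} (λ w → sum-cong-≗ {n} (λ u → sym (#-∑ (fatCherry? w u))))) ⟩
    n * (n * 3) + ∑[ w < n ] ∑[ u < n ] # (fatCherry? w u)
      ≤⟨ +-monoʳ-≤ (n * (n * 3)) (∑-mono {n} (λ w → ∑#-P₄-free (nbr? G w) (fatCherry? w)
           (λ ((w~u , _) , _) → w~u) (λ ((w~u , w~v) , fat) → (w~v , w~u) , Fat-sym G fat)
           (fatCherry-P₄-free w))) ⟩
    n * (n * 3) + ∑[ w < n ] (7 * degree G w)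
      ≡⟨ cong (n * (n * 3) +_) (sym (*-distribˡ-sum 7 (degree G))) ⟩
    n * (n * 3) + 7 * m ∎
    where
    open ≤-Reasoning
    c : Fin n → Fin n → Fin n → ℕ
    c w u v = [ fatCherry? w u v ]

  -- This says that `m`, twice the number of edges, is of order at most n to the power 3/2.
  ∑degree²≤ : m * m ≤ 10 * (n * (n * n))
  ∑degree²≤ = begin
    m * m                                       ≤⟨ cauchy-schwarz (degree G) ⟩
    n * ∑[ w < n ] (degree G w * degree G w)    ≡⟨ cong (n *_) ∑degree² ⟩
    n * ∑[ u < n ] ∑[ v < n ] codegree G u v    ≤⟨ *-monoʳ-≤ n ∑codegree≤ ⟩
    -- For the linear term the trivial m ≤ n² is enough, and 3 + 7 = 10.
    n * (n * (n * 3) + 7 * m)                   ≤⟨ *-monoʳ-≤ n (+-monoʳ-≤ (n * (n * 3)) (*-monoʳ-≤ 7 m≤n²)) ⟩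
    n * (n * (n * 3) + 7 * (n * n))             ≡⟨ collect n ⟩
    10 * (n * (n * n))                          ∎
    where
    open ≤-Reasoning
    collect : ∀ n → n * (n * (n * 3) + 7 * (n * n)) ≡ 10 * (n * (n * n))
    collect = solve-∀

    m≤n² : m ≤ n * n
    m≤n² = ≤-trans (∑-mono {n} {g = λ _ → n} (λ w → subst (degree G w ≤_) (length-tabulate (λ i → i)) (length-filter (nbr? G w) (allFin n))))
      (≤-reflexive (∑-const n n))

  -- With v and u joining the fat pairs, xₖ v xⱼ yᵢ u yₖ xᵢ yⱼ is an eight-cycle.
  fat-overlap : ∀ {S x y} → Hexagon G S x y → ∀ {i j k} → i ≢ j → i ≢ k → j ≢ k →
    Fat G (x j) (x k) → Fat G (y i) (y k) → ⊥
  fat-overlap {x = x} {y} H {i} {j} {k} i≢j i≢k j≢k fat-x fat-y =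
    let (v , xk~v , v~xj , v∉) = fat-fresh G (Fat-sym G fat-x) (y i ∷ y j ∷ y k ∷ []) ≤-refl
        (u , yi~u , u~yk , u∉) = fat-fresh G fat-y (x i ∷ x j ∷ x k ∷ []) ≤-refl
    in no-C₈ G bip C₈-free
      (distinct₄ (j≢k ∘ sym ∘ x-inj) (u∉ ∘ there ∘ there ∘ here ∘ sym) (i≢k ∘ sym ∘ x-inj)
        (u∉ ∘ there ∘ here ∘ sym) (i≢j ∘ sym ∘ x-inj) (u∉ ∘ here))
      (distinct₄ (v∉ ∘ here) (v∉ ∘ there ∘ there ∘ here) (v∉ ∘ there ∘ here)
        (i≢k ∘ y-inj) (i≢j ∘ y-inj) (j≢k ∘ sym ∘ y-inj))
      xk~v v~xj (x~y (i≢j ∘ sym)) yi~u u~yk (~-sym _ _ (x~y i≢k)) (x~y i≢j) (~-sym _ _ (x~y (j≢k ∘ sym)))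
    where open Hexagon H

  -- A vertex x′ₖ outside x would close the path xⱼ v xₖ w xᵢ up to an eight-cycle via yᵢ and yⱼ.
  allFat-determined : ∀ {S S′ x x′ y y′} → Hexagon G S x y → Hexagon G S′ x′ y′ → y ≗ y′ →
    AllFat G x → ∀ k → ∃[ l ] x′ k ≡ x l
  allFat-determined {x = x} {x′} {y} {y′} H H′ y≗ fat k with Fin.any? (λ l → x′ k Fin.≟ x l)
  ... | yes p = p
  ... | no x′k∉x with i , j , i≢j , i≢k , j≢k ← others k =
    let (v , xj~v , v~xk , v∉) = fat-fresh G (fat j k j≢k) (y i ∷ y j ∷ []) (s≤s (s≤s (s≤s z≤n)))
        (w , xk~w , w~xi , w∉) = fat-fresh G (fat k i (i≢k ∘ sym)) (v ∷ y i ∷ y j ∷ []) ≤-refl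
    in ⊥-elim (no-C₈ G bip C₈-free
      (distinct₄ (λ e → x′k∉x (j , e)) (λ e → x′k∉x (k , e)) (λ e → x′k∉x (i , e))
        (j≢k ∘ H.x-inj) (i≢j ∘ sym ∘ H.x-inj) (i≢k ∘ sym ∘ H.x-inj))
      (distinct₄ (v∉ ∘ here ∘ sym) (w∉ ∘ there ∘ here ∘ sym) (i≢j ∘ H.y-inj)
        (w∉ ∘ here ∘ sym) (v∉ ∘ there ∘ here) (w∉ ∘ there ∘ there ∘ here))
      (x′k~ i≢k) (~-sym _ _ (H.x~y (i≢j ∘ sym))) xj~v v~xk xk~w w~xi (H.x~y i≢j) (~-sym _ _ (x′k~ j≢k)))
    where
    module H = Hexagon H
    module H′ = Hexagon H′
    x′k~ : ∀ {l} → l ≢ k → x′ k ~ y l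
    x′k~ {l} l≢k = subst (x′ k ~_) (sym (y≗ l)) (H′.x~y (l≢k ∘ sym))

-- Encoding the hexagons

length-cartesianProductWith : ∀ {A B C : Set} (f : A → B → C) xs ys →
  length (cartesianProductWith f xs ys) ≡ length xs * length ys
length-cartesianProductWith f []       ys = refl
length-cartesianProductWith f (x ∷ xs) ys = trans (length-++ (List.map (f x) ys))
  (cong₂ _+_ (length-map (f x) ys) (length-cartesianProductWith f xs ys))

length-allFin : ∀ n → length (allFin n) ≡ n
length-allFin n = length-tabulate {n = n} (λ i → i)

length-vectors : ∀ {A : Set} (xs : List A) m → length (vectors xs m) ≡ length xs ^ m
length-vectors xs zero    = refl
length-vectors xs (suc m) = trans (length-cartesianProductWith Vec._∷_ xs (vectors xs m))
  (cong (length xs *_) (length-vectors xs m))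

∈-concatMap : ∀ {A B : Set} {f : A → List B} {xs x y} → x ∈ xs → y ∈ f x → y ∈ concatMap f xs
∈-concatMap {f = f} x∈ y∈ = ∈-concatMap⁺ f (lose x∈ y∈)

module _ {n} (G : Graph n) where
  open Graph G

  edges : List (Fin n × Fin n)
  edges = concatMap (λ u → List.map (u ,_) (filter (nbr? G u) (allFin n))) (allFin n)

  length-edges : length edges ≡ ∑[ u < n ] degree G u
  length-edges = trans
    (length-concatMap-tabulate (λ u → List.map (u ,_) (filter (nbr? G u) (allFin n))) (λ i → i))
    (sum-cong-≗ {n} λ u → length-map (u ,_) (filter (nbr? G u) (allFin n)))

  ∈-edges : ∀ {u w} → u ~ w → (u , w) ∈ edges
  ∈-edges {u} {w} u~w = ∈-concatMap {f = λ u → List.map (u ,_) (filter (nbr? G u) (allFin n))}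
    (∈-allFin u) (∈-map⁺ (u ,_) (∈-filter⁺ (nbr? G u) (∈-allFin w) u~w))

  -- All common neighbours, unless the pair is fat.
  few : Fin n → Fin n → List (Fin n)
  few u v = take 3 (filter (common? G u v) (allFin n))

  length-few≤ : ∀ u v → length (few u v) ≤ 3
  length-few≤ u v = ≤-trans (≤-reflexive (length-take 3 (filter (common? G u v) (allFin n)))) (m⊓n≤m 3 _)

  ∈-few : ∀ {u v w} → ¬ Fat G u v → u ~ w → v ~ w → w ∈ few u v
  ∈-few {u} {v} {w} ¬fat u~w v~w = subst (w ∈_)
    (sym (take-all 3 (filter (common? G u v) (allFin n)) (≤-pred (≰⇒> ¬fat))))
    (∈-filter⁺ (common? G u v) (∈-allFin w) (u~w , v~w))

  -- The inner vertices of a path v a b c u. In a bipartite graph the three inequalities separate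
  -- them from each other and from the ends.
  Path₄ : Fin n → Fin n → Set
  Path₄ u v = ∃[ a ] ∃[ b ] ∃[ c ] (v ~ a × a ~ b × b ~ c × c ~ u × a ≢ c × b ≢ u × b ≢ v)

  path₄? : ∀ u v → Dec (Path₄ u v)
  path₄? u v = Fin.any? λ a → Fin.any? λ b → Fin.any? λ c →
    nbr? G v a ×-dec nbr? G a b ×-dec nbr? G b c ×-dec nbr? G c u ×-dec
    ¬? (a Fin.≟ c) ×-dec ¬? (b Fin.≟ u) ×-dec ¬? (b Fin.≟ v)

  -- Where a hexagon path with the same ends can meet the chosen path next to its end `w`: at `a`,
  -- at `c` or, if the middle vertices agree, at a common neighbour of `b` and `w`. The empty
  -- default is harmless, since a hexagon with y₀ = u and y₁ = v itself supplies a path.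
  candidates : ∀ {u v} → Dec (Path₄ u v) → Fin n → List (Fin n)
  candidates (yes (a , b , c , _)) w = a ∷ c ∷ few b w
  candidates (no _)                w = []

  length-candidates≤ : ∀ {u v} (p? : Dec (Path₄ u v)) w → length (candidates p? w) ≤ 5
  length-candidates≤ (yes (_ , b , _)) w = s≤s (s≤s (length-few≤ b w))
  length-candidates≤ (no _)            w = z≤n

  -- The second list, with the path chosen for the opposite order of the ends, serves hexagons whose
  -- labels 0 and 1 are exchanged before encoding.
  pool : Fin n → Fin n → List (Fin n)
  pool u v = candidates (path₄? u v) v ++ candidates (path₄? v u) v

  length-pool≤ : ∀ u v → length (pool u v) ≤ 10
  length-pool≤ u v = ≤-trans (≤-reflexive (length-++ (candidates (path₄? u v) v)))
    (+-mono-≤ (length-candidates≤ (path₄? u v) v) (length-candidates≤ (path₄? v u) v))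

  Labels : Set
  Labels = Vec (Fin n) 3 × Vec (Fin n) 3

  -- (a w c , u v b) stands for a hexagon with x = (a , w , c) and y = (u , v , b), where uv and aw are light:
  -- v and the edge uw are free, a comes from the pool, and b and c are among at most three
  -- common neighbours each.
  lightCodes : List Labels
  lightCodes = concatMap extend (cartesianProduct (allFin n) edges)
    module LightCodes where
    third : Fin n → Fin n → Fin n → Fin n → Fin n → List Labels
    third v u w a b = List.map (λ c → a ∷ w ∷ c ∷ [] , u ∷ v ∷ b ∷ []) (few u v)

    second : Fin n → Fin n → Fin n → Fin n → List Labels
    second v u w a = concatMap (third v u w a) (few a w)

    extend : Fin n × Fin n × Fin n → List Labels
    extend (v , u , w) = concatMap (second v u w) (pool u v)
  open LightCodes

  -- The factor is 90 = 10 · 3 · 3: ten members of the pool and three choices for each of `b` and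
  -- `c`.
  length-lightCodes≤ : length lightCodes ≤ n * ∑[ u < n ] degree G u * 90
  length-lightCodes≤ = ≤-trans
    (length-concatMap≤ extend length-extend≤ (cartesianProduct (allFin n) edges))
    (≤-reflexive (cong (_* 90) (trans (length-cartesianProductWith _,_ (allFin n) edges)
      (cong₂ _*_ (length-allFin n) length-edges))))
    where
    length-second≤ : ∀ v u w a → length (second v u w a) ≤ 9
    length-second≤ v u w a = ≤-trans
      (length-concatMap≤ (third v u w a) (λ b → ≤-trans (≤-reflexive (length-map _ (few u v))) (length-few≤ u v)) (few a w))
      (*-monoˡ-≤ 3 (length-few≤ a w))

    length-extend≤ : ∀ e → length (extend e) ≤ 90
    length-extend≤ (v , u , w) = ≤-trans
      (length-concatMap≤ (second v u w) (length-second≤ v u w) (pool u v))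
      (*-monoˡ-≤ 9 (length-pool≤ u v))

  ∈-lightCodes : ∀ {v u w a b c} → u ~ w → a ∈ pool u v → b ∈ few a w → c ∈ few u v →
    (a ∷ w ∷ c ∷ [] , u ∷ v ∷ b ∷ []) ∈ lightCodes
  ∈-lightCodes {v} {u} {w} {a} {b} u~w a∈ b∈ c∈ = ∈-concatMap {f = extend}
    (∈-cartesianProduct⁺ (∈-allFin v) (∈-edges u~w))
    (∈-concatMap {f = second v u w} a∈ (∈-concatMap {f = third v u w a} b∈
      (∈-map⁺ (λ c → a ∷ w ∷ c ∷ [] , u ∷ v ∷ b ∷ []) c∈)))

  -- FatAt z k concerns the two labels other than k, in cyclic order.
  FatAt : (Fin 3 → Fin n) → Fin 3 → Set
  FatAt z k = Fat G (z (rotate ⟨$⟩ʳ k)) (z (rotate ⟨$⟩ˡ k))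

  fatAt? : ∀ z → Decidable (FatAt z)
  fatAt? z k = fat? G (z (rotate ⟨$⟩ʳ k)) (z (rotate ⟨$⟩ˡ k))

  fatAt⇒allFat : ∀ {x} → (∀ k → FatAt x k) → AllFat G x
  fatAt⇒allFat fat 0F 0F i≢j = contradiction refl i≢j
  fatAt⇒allFat fat 0F 1F i≢j = fat 2F
  fatAt⇒allFat fat 0F 2F i≢j = Fat-sym G (fat 1F)
  fatAt⇒allFat fat 1F 0F i≢j = Fat-sym G (fat 2F)
  fatAt⇒allFat fat 1F 1F i≢j = contradiction refl i≢j
  fatAt⇒allFat fat 1F 2F i≢j = fat 0F
  fatAt⇒allFat fat 2F 0F i≢j = fat 1F
  fatAt⇒allFat fat 2F 1F i≢j = Fat-sym G (fat 0F)
  fatAt⇒allFat fat 2F 2F i≢j = contradiction refl i≢j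

  -- Rotations respect the cyclic order in `FatAt`, so moving label `k` to 2 preserves the
  -- hypothesis by computation.
  to-last : ∀ k → ∃[ π ] ∀ z → ¬ FatAt z k → ¬ FatAt (z ∘ (π ⟨$⟩ʳ_)) 2F
  to-last 0F = rotate , λ _ ¬f → ¬f
  to-last 1F = flip rotate , λ _ ¬f → ¬f
  to-last 2F = idₚ , λ _ ¬f → ¬f

  Code : Set
  Code = Vec (Fin n) 3 ⊎ Labels

  -- In the fat case only `y` is recorded, in the order that sorts `x`. Either side of a hexagon may
  -- play `x`, so both kinds of fat hexagons share the same n³ codes, and the leading coefficient is
  -- 1.
  Encodes : VE n → Code → Set
  Encodes S (inj₁ c)       = ∃[ x ] ∃[ y ] (Hexagon G S x y × Sorted x × AllFat G x × y ≗ Vec.lookup c)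
  Encodes S (inj₂ (c , d)) = ∃[ x ] ∃[ y ] (Hexagon G S x y × x ≗ Vec.lookup c × y ≗ Vec.lookup d)

  codes : List Code
  codes = List.map inj₁ (vectors (allFin n) 3) ++ List.map inj₂ lightCodes

module _ {n} (G : Graph n) (bip : Bipartite G) (C₈-free : Free (Cycle 8) G) where
  open Graph G

  -- For i ≠ j the two fat pairs share the third label, which is the configuration excluded by
  -- `fat-overlap`.
  fatAt-same : ∀ {S x y} → Hexagon G S x y → ∀ {i j} → FatAt G x i → FatAt G y j → i ≡ j
  fatAt-same {x = x} {y} H {i} {j} fx fy with i Fin.≟ j
  ... | yes i≡j = i≡j
  ... | no i≢j  = ⊥-elim (go i j i≢j fx fy)
    where
    clash = fat-overlap G bip C₈-free H
    go : ∀ i j → i ≢ j → FatAt G x i → FatAt G y j → ⊥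
    go 0F 0F i≢j _ _ = i≢j refl
    go 0F 1F _ p q = clash {0F} {1F} {2F} (λ ()) (λ ()) (λ ()) p (Fat-sym G q)
    go 0F 2F _ p q = clash {0F} {2F} {1F} (λ ()) (λ ()) (λ ()) (Fat-sym G p) q
    go 1F 0F _ p q = clash {1F} {0F} {2F} (λ ()) (λ ()) (λ ()) (Fat-sym G p) q
    go 1F 1F i≢j _ _ = i≢j refl
    go 1F 2F _ p q = clash {1F} {2F} {0F} (λ ()) (λ ()) (λ ()) p (Fat-sym G q)
    go 2F 0F _ p q = clash {2F} {0F} {1F} (λ ()) (λ ()) (λ ()) p (Fat-sym G q)
    go 2F 1F _ p q = clash {2F} {1F} {0F} (λ ()) (λ ()) (λ ()) (Fat-sym G p) q
    go 2F 2F i≢j _ _ = i≢j refl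

  -- In the fat case `y` determines the set of the x's, and sorting fixes their order.
  encodes-injective : ∀ {S S′ c} → Encodes G S c → Encodes G S′ c → S ≡ S′
  encodes-injective {c = inj₁ c} (x , y , H , sx , fat , y≗) (x′ , y′ , H′ , sx′ , _ , y′≗) =
    hexagon-unique H H′ (sorted-unique sx sx′ (allFat-determined G bip C₈-free H H′ y≗y′ fat)) y≗y′
    where
    y≗y′ : y ≗ y′
    y≗y′ i = trans (y≗ i) (sym (y′≗ i))
  encodes-injective {c = inj₂ (c , d)} (x , y , H , x≗ , y≗) (x′ , y′ , H′ , x′≗ , y′≗) =
    hexagon-unique H H′ (λ i → trans (x≗ i) (sym (x′≗ i))) (λ i → trans (y≗ i) (sym (y′≗ i)))

  encode-fat : ∀ {S x y} → Hexagon G S x y → AllFat G x → ∃[ c ] c ∈ codes G × Encodes G S c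
  encode-fat {x = x} {y} H fat with π , sorted ← sort x (Hexagon.x-inj H) =
    inj₁ (Vec.tabulate (y ∘ (π ⟨$⟩ʳ_))) , ∈-++⁺ˡ (∈-map⁺ inj₁ (∈-vectors ∈-allFin _)) ,
    _ , _ , Hπ , sorted , (λ i j i≢j → fat _ _ (λ e → i≢j (Hexagon.x-inj Hπ (cong x e)))) ,
    λ i → sym (lookup∘tabulate (y ∘ (π ⟨$⟩ʳ_)) i)
    where Hπ = hexagon-permute π H

  -- Lightness at label 2 makes y₂ one of the few common neighbours of x₀ and x₁, and x₂ one of
  -- those of y₀ and y₁.
  encode-pool : ∀ {S x y} → Hexagon G S x y → ¬ FatAt G x 2F → ¬ FatAt G y 2F →
    x 0F ∈ pool G (y 0F) (y 1F) → ∃[ c ] c ∈ codes G × Encodes G S c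
  encode-pool {x = x} {y} H ¬fx ¬fy x₀∈ =
    inj₂ (x 0F ∷ x 1F ∷ x 2F ∷ [] , y 0F ∷ y 1F ∷ y 2F ∷ []) ,
    ∈-++⁺ʳ (List.map inj₁ (vectors (allFin n) 3)) (∈-map⁺ inj₂ (∈-lightCodes G (~-sym _ _ (x~y λ ())) x₀∈
      (∈-few G ¬fx (x~y λ ()) (x~y λ ())) (∈-few G ¬fy (~-sym _ _ (x~y λ ())) (~-sym _ _ (x~y λ ()))))) ,
    x , y , H , (λ { 0F → refl ; 1F → refl ; 2F → refl }) , (λ { 0F → refl ; 1F → refl ; 2F → refl })
    where open Hexagon H

  -- Otherwise y₁ x₀ y₂ x₁ y₀ and the path of p? have no inner vertex in common and form an eight-cycle.
  path₄-meets : ∀ {S x y} → Hexagon G S x y → (p? : Dec (Path₄ G (y 0F) (y 1F))) →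
    ¬ FatAt G y 0F ⊎ ¬ FatAt G y 1F →
    x 0F ∈ candidates G p? (y 1F) ⊎ x 1F ∈ candidates G p? (y 0F)
  path₄-meets {x = x} {y} H (no ¬p) _ = contradiction
    (x 0F , y 2F , x 1F , ~-sym _ _ (x~y λ ()) , x~y (λ ()) , ~-sym _ _ (x~y λ ()) , x~y (λ ()) ,
      (λ e → contradiction (x-inj e) λ ()) , (λ e → contradiction (y-inj e) λ ()) , λ e → contradiction (y-inj e) λ ()) ¬p
    where open Hexagon H
  path₄-meets {x = x} {y} H (yes (a , b , c , y₁~a , a~b , b~c , c~y₀ , a≢c , b≢y₀ , b≢y₁)) ¬fat
    with x 0F Fin.≟ a | x 0F Fin.≟ c | x 1F Fin.≟ a | x 1F Fin.≟ c | b Fin.≟ y 2F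
  ... | yes e | _ | _ | _ | _ = inj₁ (here e)
  ... | _ | yes e | _ | _ | _ = inj₁ (there (here e))
  ... | _ | _ | yes e | _ | _ = inj₂ (here e)
  ... | _ | _ | _ | yes e | _ = inj₂ (there (here e))
  ... | no x₀≢a | no x₀≢c | no x₁≢a | no x₁≢c | no b≢y₂ = ⊥-elim (no-C₈ G bip C₈-free
    (distinct₄ (λ e → contradiction (y-inj e) λ ()) (λ e → contradiction (y-inj e) λ ()) (b≢y₁ ∘ sym)
      (λ e → contradiction (y-inj e) λ ()) (b≢y₂ ∘ sym) (b≢y₀ ∘ sym))
    (distinct₄ (λ e → contradiction (x-inj e) λ ()) x₀≢c x₀≢a x₁≢c x₁≢a (a≢c ∘ sym))
    (~-sym _ _ (x~y λ ())) (x~y λ ()) (~-sym _ _ (x~y λ ())) (x~y λ ())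
    (~-sym _ _ c~y₀) (~-sym _ _ b~c) (~-sym _ _ a~b) (~-sym _ _ y₁~a))
    where open Hexagon H
  ... | _ | _ | _ | _ | yes refl with ¬fat
  ...   | inj₁ ¬f = inj₁ (there (there (∈-few G (¬f ∘ Fat-sym G) (~-sym _ _ (x~y λ ())) (~-sym _ _ (x~y λ ())))))
    where open Hexagon H
  ...   | inj₂ ¬f = inj₂ (there (there (∈-few G ¬f (~-sym _ _ (x~y λ ())) (~-sym _ _ (x~y λ ())))))
    where open Hexagon H

  encode-light : ∀ {S x y} → Hexagon G S x y → ¬ FatAt G x 2F → ¬ FatAt G y 2F →
    ¬ FatAt G y 0F ⊎ ¬ FatAt G y 1F → ∃[ c ] c ∈ codes G × Encodes G S c
  encode-light {x = x} {y} H ¬fx ¬fy ¬fat with path₄-meets H (path₄? G (y 0F) (y 1F)) ¬fat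
  ... | inj₁ x₀∈ = encode-pool H ¬fx ¬fy (∈-++⁺ˡ x₀∈)
  ... | inj₂ x₁∈ = encode-pool (hexagon-permute (transpose 0F 1F) H) (¬fx ∘ Fat-sym G) (¬fy ∘ Fat-sym G)
    (∈-++⁺ʳ (candidates G (path₄? G (y 1F) (y 0F)) (y 0F)) x₁∈)

  encode-doubly-light : ∀ {S x y} → Hexagon G S x y → ∀ k → ¬ FatAt G x k → ¬ FatAt G y k →
    ∃[ c ] c ∈ codes G × Encodes G S c
  encode-doubly-light {x = x} {y} H k ¬fx ¬fy with π , last ← to-last G k =
    go (fatAt? G (y ∘ (π ⟨$⟩ʳ_)) 0F) (fatAt? G (y ∘ (π ⟨$⟩ʳ_)) 1F)
    where
    Hπ = hexagon-permute π H
    go : Dec (FatAt G (y ∘ (π ⟨$⟩ʳ_)) 0F) → Dec (FatAt G (y ∘ (π ⟨$⟩ʳ_)) 1F) →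
      ∃[ c ] c ∈ codes G × Encodes G _ c
    go (no ¬f) _ = encode-light Hπ (last x ¬fx) (last y ¬fy) (inj₁ ¬f)
    go (yes _) (no ¬f) = encode-light Hπ (last x ¬fx) (last y ¬fy) (inj₂ ¬f)
    -- Here y₂ is fat with both y₀ and y₁. A fat pair x₁ x₂ would clash with the fat pair y₂ y₀, so
    -- the hypothesis holds after the sides are exchanged.
    go (yes _) (yes f₁) = encode-light (hexagon-swap Hπ) (last y ¬fy) (last x ¬fx)
      (inj₁ λ g → contradiction (fatAt-same Hπ {0F} {1F} g f₁) λ ())

  -- If neither side is all fat, some label is light on both sides: otherwise a label light only for
  -- `x` and one light only for `y` would be distinct and carry fat pairs on opposite sides, against
  -- `fatAt-same`.
  encode : ∀ {S x y} → Hexagon G S x y → ∃[ c ] c ∈ codes G × Encodes G S c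
  encode {x = x} {y} H with Fin.all? (fatAt? G x) | Fin.all? (fatAt? G y)
  ... | yes fat | _       = encode-fat H (fatAt⇒allFat G fat)
  ... | no _    | yes fat = encode-fat (hexagon-swap H) (fatAt⇒allFat G fat)
  ... | no ¬fx  | no ¬fy
    with i , ¬fxi ← Fin.¬∀⟶∃¬ 3 _ (fatAt? G x) ¬fx
    with j , ¬fyj ← Fin.¬∀⟶∃¬ 3 _ (fatAt? G y) ¬fy
    with fatAt? G y i | fatAt? G x j
  ... | no ¬fyi | _       = encode-doubly-light H i ¬fxi ¬fyi
  ... | yes _   | no ¬fxj = encode-doubly-light H j ¬fxj ¬fyj
  ... | yes fyi | yes fxj = contradiction (subst (FatAt G x) (fatAt-same H {j} {i} fxj fyi) fxj) ¬fxi

  #C₆≤ : #copies (Cycle 6) G ≤ n ^ 3 + n * ∑[ u < n ] degree G u * 90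
  #C₆≤ = ≤-trans
    (length-injects (Encodes G) {ys = codes G} (copies-unique (Cycle 6) G)
      (λ {S} S∈ → let (S⊑G , f , inj , im , adj) = Equivalence.to (∈-copies (Cycle 6) G S) S∈ in
        encode (isIso⇒hexagon S⊑G f inj im adj))
      encodes-injective)
    (begin
      length (codes G)
        ≡⟨ length-++ (List.map inj₁ (vectors (allFin n) 3)) ⟩
      length (List.map inj₁ (vectors (allFin n) 3)) + length (List.map inj₂ (lightCodes G))
        ≡⟨ cong₂ _+_ (trans (length-map inj₁ (vectors (allFin n) 3)) (trans (length-vectors (allFin n) 3)
             (cong (_^ 3) (length-allFin n)))) (length-map inj₂ (lightCodes G)) ⟩
      n ^ 3 + length (lightCodes G)
        ≤⟨ +-monoʳ-≤ (n ^ 3) (length-lightCodes≤ G) ⟩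
      n ^ 3 + n * ∑[ u < n ] degree G u * 90 ∎)
    where open ≤-Reasoning

-- The extremal graph

module _ (n : ℕ) where

  Low : Fin n → Set
  Low v = toℕ v < 3

  low? : Decidable Low
  low? v = toℕ v <? 3

  Across : Fin n → Fin n → Set
  Across u v = (Low u × ¬ Low v) ⊎ (¬ Low u × Low v)

  across? : ∀ u → Decidable (Across u)
  across? u v = (low? u ×-dec ¬? (low? v)) ⊎-dec (¬? (low? u) ×-dec low? v)

  K₃,ₙ₋₃ : Graph n
  K₃,ₙ₋₃ = graph (matrix across?)
    (λ u v → Equivalence.from (∈-matrix⇔ across? v u) ∘ turn ∘ Equivalence.to (∈-matrix⇔ across? u v))
    (λ u → loopless ∘ Equivalence.to (∈-matrix⇔ across? u u))
    where
    turn : ∀ {u v} → Across u v → Across v u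
    turn (inj₁ (l , h)) = inj₂ (h , l)
    turn (inj₂ (h , l)) = inj₁ (l , h)
    loopless : ∀ {u} → ¬ Across u u
    loopless (inj₁ (l , h)) = h l
    loopless (inj₂ (h , l)) = h l

  K₃,ₙ₋₃-bipartite : Bipartite K₃,ₙ₋₃
  K₃,ₙ₋₃-bipartite = Vec.tabulate (does ∘ low?) , λ u v u~v → side (Equivalence.to (∈-matrix⇔ across? u v) u~v)
    where
    X : Subset.Subset n
    X = Vec.tabulate (does ∘ low?)
    side : ∀ {u v} → Across u v → (u Subset.∈ X × v Subset.∉ X) ⊎ (u Subset.∉ X × v Subset.∈ X)
    side {u} {v} (inj₁ (l , h)) =
      inj₁ (Equivalence.from (∈-tabulate⇔ low? u) l , h ∘ Equivalence.to (∈-tabulate⇔ low? v))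
    side {u} {v} (inj₂ (h , l)) =
      inj₂ (h ∘ Equivalence.to (∈-tabulate⇔ low? u) , Equivalence.from (∈-tabulate⇔ low? v) l)

  low-at-most-3 : ∀ {k} (g : Fin k → Fin n) → Injective _≡_ _≡_ g → (∀ i → Low (g i)) → k ≤ 3
  low-at-most-3 g g-inj low = Fin.injective⇒≤ {f = λ i → Fin.fromℕ< (low i)} λ {i} {j} e →
    g-inj (Fin.toℕ-injective (Fin.fromℕ<-injective _ _ (low i) (low j) e))

  -- An eight-cycle alternates between the sides and would need four of the three low vertices.
  K₃,ₙ₋₃-C₈-free : Free (Cycle 8) K₃,ₙ₋₃
  K₃,ₙ₋₃-C₈-free (S , (_ , _ , S⊆G) , f , f-inj , _ , adj) = go (low? (f 0F))
    where
    next : Fin 8 → Fin 8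
    next = Vec.lookup (1F ∷ 2F ∷ 3F ∷ 4F ∷ 5F ∷ 6F ∷ 7F ∷ 0F ∷ [])

    ~next : ∀ i → next i Subset.∈ Vec.lookup (cycleNbhd 8) i
    ~next = from-yes (Fin.all? λ i → cycle~? 8 i (next i))

    across-next : ∀ i → Across (f i) (f (next i))
    across-next i = Equivalence.to (∈-matrix⇔ across? (f i) (f (next i)))
      (S⊆G _ _ (Equivalence.to (adj i (next i)) (~next i)))

    evens odds : Fin 4 → Fin 8
    evens = Vec.lookup (0F ∷ 2F ∷ 4F ∷ 6F ∷ [])
    odds  = Vec.lookup (1F ∷ 3F ∷ 5F ∷ 7F ∷ [])

    evens-inj : ∀ i j → evens i ≡ evens j → i ≡ j
    evens-inj = from-yes (all₂? {4} {4} λ i j → (evens i Fin.≟ evens j) →-dec (i Fin.≟ j))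
    odds-inj : ∀ i j → odds i ≡ odds j → i ≡ j
    odds-inj = from-yes (all₂? {4} {4} λ i j → (odds i Fin.≟ odds j) →-dec (i Fin.≟ j))

    leave : ∀ i → Low (f i) → ¬ Low (f (next i))
    leave i l with across-next i
    ... | inj₁ (_ , h) = h
    ... | inj₂ (h , _) = contradiction l h

    enter : ∀ i → ¬ Low (f i) → Low (f (next i))
    enter i h with across-next i
    ... | inj₁ (l , _) = contradiction l h
    ... | inj₂ (_ , l) = l

    skip : ∀ i → Low (f i) → Low (f (next (next i)))
    skip i l = enter (next i) (leave i l)

    go : Dec (Low (f 0F)) → ⊥
    go (yes l₀) = <-irrefl refl (low-at-most-3 (f ∘ evens) (λ {i} {j} e → evens-inj i j (f-inj e)) λ
      { 0F → l₀
      ; 1F → skip 0F l₀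
      ; 2F → skip 2F (skip 0F l₀)
      ; 3F → skip 4F (skip 2F (skip 0F l₀)) })
    go (no h₀) = <-irrefl refl (low-at-most-3 (f ∘ odds) (λ {i} {j} e → odds-inj i j (f-inj e)) λ
      { 0F → enter 0F h₀
      ; 1F → skip 1F (enter 0F h₀)
      ; 2F → skip 3F (skip 1F (enter 0F h₀))
      ; 3F → skip 5F (skip 3F (skip 1F (enter 0F h₀))) })

-- Within `S`, the vertex opposite to `x i` is the only common neighbour of the other two x's.
hexagon-opposites-unique : ∀ {n} {G : Graph n} {S x x′ y y′} → x ≗ x′ → (∀ i j → x i ≢ y j) →
  Hexagon G S x y → Hexagon G S x′ y′ → y′ ≗ y
hexagon-opposites-unique {S = S} {x} {x′} {y} {y′} x≗x′ x≢y H H′ i =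
  let (j , k , j≢k , j≢i , k≢i) = others i
      (l , l≢j , e) = neighbour j≢i
      (l′ , l′≢k , e′) = neighbour k≢i
      l≡l′ = Hexagon.y-inj H (trans (sym e) e′)
  in trans e (cong y (remaining i j k l j≢k j≢i k≢i l≢j (λ l≡k → l′≢k (trans (sym l≡l′) l≡k))))
  where
  neighbour : ∀ {j} → j ≢ i → ∃[ l ] (l ≢ j × y′ i ≡ y l)
  neighbour {j} j≢i with Equivalence.to (Hexagon.arcs H (x j) (y′ i))
      (Equivalence.from (Hexagon.arcs H′ (x j) (y′ i)) (j , i , j≢i , inj₁ (x≗x′ j , refl)))
  ... | j′ , l , j′≢l , inj₁ (e , e′) = l , (λ l≡j → j′≢l (trans (sym (Hexagon.x-inj H e)) (sym l≡j))) , e′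
  ... | _ , l , _ , inj₂ (e , _) = contradiction e (x≢y j l)

  remaining : ∀ (i j k l : Fin 3) → j ≢ k → j ≢ i → k ≢ i → l ≢ j → l ≢ k → l ≡ i
  remaining = from-yes (Fin.all? {3} λ i → Fin.all? {3} λ j → Fin.all? {3} λ k → Fin.all? {3} λ l →
    ¬? (j Fin.≟ k) →-dec ¬? (j Fin.≟ i) →-dec ¬? (k Fin.≟ i) →-dec ¬? (l Fin.≟ j) →-dec ¬? (l Fin.≟ k) →-dec (l Fin.≟ i))

-- Hexagons from ordered triples

module _ (k : ℕ) where
  private
    n : ℕ
    n = 5 + k

    G : Graph n
    G = K₃,ₙ₋₃ n

  -- Encodes the ordered triples of distinct vertices on the large side, which has 2 + k vertices;
  -- `punchIn` skips those already chosen.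
  Triple : Set
  Triple = Fin (2 + k) × Fin (1 + k) × Fin k

  triples : List Triple
  triples = cartesianProduct (allFin (2 + k)) (cartesianProduct (allFin (1 + k)) (allFin k))

  triples-unique : Unique triples
  triples-unique = Unique.cartesianProduct⁺ (Unique.allFin⁺ (2 + k))
    (Unique.cartesianProduct⁺ (Unique.allFin⁺ (1 + k)) (Unique.allFin⁺ k))

  length-triples : length triples ≡ (2 + k) * ((1 + k) * k)
  length-triples = trans
    (length-cartesianProductWith _,_ (allFin (2 + k)) (cartesianProduct (allFin (1 + k)) (allFin k)))
    (cong₂ _*_ (length-allFin (2 + k)) (trans
      (length-cartesianProductWith _,_ (allFin (1 + k)) (allFin k))
      (cong₂ _*_ (length-allFin (1 + k)) (length-allFin k))))

  distinct-triple : Triple → Fin 3 → Fin (2 + k)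
  distinct-triple (a , b , c) 0F = a
  distinct-triple (a , b , c) 1F = punchIn a b
  distinct-triple (a , b , c) 2F = punchIn a (punchIn b c)

  distinct-triple-inj : ∀ t → Injective _≡_ _≡_ (distinct-triple t)
  distinct-triple-inj (a , b , c) {i} {j} = go i j
    where
    go : ∀ i j → distinct-triple (a , b , c) i ≡ distinct-triple (a , b , c) j → i ≡ j
    go 0F 0F _ = refl
    go 0F 1F e = contradiction (sym e) (Fin.punchInᵢ≢i a b)
    go 0F 2F e = contradiction (sym e) (Fin.punchInᵢ≢i a (punchIn b c))
    go 1F 0F e = contradiction e (Fin.punchInᵢ≢i a b)
    go 1F 1F _ = refl
    go 1F 2F e = contradiction (sym (Fin.punchIn-injective a _ _ e)) (Fin.punchInᵢ≢i b c)
    go 2F 0F e = contradiction e (Fin.punchInᵢ≢i a (punchIn b c))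
    go 2F 1F e = contradiction (Fin.punchIn-injective a _ _ e) (Fin.punchInᵢ≢i b c)
    go 2F 2F _ = refl

  distinct-triple-determines : ∀ {t t′} → distinct-triple t ≗ distinct-triple t′ → t ≡ t′
  distinct-triple-determines {a , b , c} {a′ , b′ , c′} e with refl ← e 0F
    with refl ← Fin.punchIn-injective a b b′ (e 1F)
    with refl ← Fin.punchIn-injective b c c′ (Fin.punchIn-injective a _ _ (e 2F)) = refl

  place : Triple → Fin 3 ⊎ Fin 3 → Fin n
  place t (inj₁ i) = i ↑ˡ (2 + k)
  place t (inj₂ i) = 3 ↑ʳ distinct-triple t i

  low-place : ∀ t i → Low n (place t (inj₁ i))
  low-place t i = subst (_< 3) (sym (Fin.toℕ-↑ˡ i (2 + k))) (Fin.toℕ<n i)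

  ¬low-place : ∀ t i → ¬ Low n (place t (inj₂ i))
  ¬low-place t i = ≤⇒≯ (subst (3 ≤_) (sym (Fin.toℕ-↑ʳ 3 (distinct-triple t i))) (m≤m+n 3 _))

  place-inj : ∀ t p q → place t p ≡ place t q → p ≡ q
  place-inj t (inj₁ i) (inj₁ j) e = cong inj₁ (Fin.↑ˡ-injective (2 + k) i j e)
  place-inj t (inj₁ i) (inj₂ j) e = contradiction (subst (Low n) e (low-place t i)) (¬low-place t j)
  place-inj t (inj₂ i) (inj₁ j) e = contradiction (subst (Low n) (sym e) (low-place t j)) (¬low-place t i)
  place-inj t (inj₂ i) (inj₂ j) e = cong inj₂ (distinct-triple-inj t (Fin.↑ʳ-injective 3 _ _ e))

  -- The cyclic order x₀ y₂ x₁ y₀ x₂ y₁, so that `even` and `odd` read off the two sides.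
  side : Fin 6 → Fin 3 ⊎ Fin 3
  side = Vec.lookup (inj₁ 0F ∷ inj₂ 2F ∷ inj₁ 1F ∷ inj₂ 0F ∷ inj₁ 2F ∷ inj₂ 1F ∷ [])

  private
    _≟ₛ_ : (p q : Fin 3 ⊎ Fin 3) → Dec (p ≡ q)
    _≟ₛ_ = Sum.≡-dec Fin._≟_ Fin._≟_

  side-inj : ∀ i j → side i ≡ side j → i ≡ j
  side-inj = from-yes (all₂? {6} {6} λ i j → (side i ≟ₛ side j) →-dec (i Fin.≟ j))

  side-even : ∀ i → side (even i) ≡ inj₁ i
  side-even = from-yes (Fin.all? λ i → side (even i) ≟ₛ inj₁ i)

  side-odd : ∀ i → side (odd i) ≡ inj₂ i
  side-odd = from-yes (Fin.all? λ i → side (odd i) ≟ₛ inj₂ i)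

  sides-differ : ∀ i j → j Subset.∈ Vec.lookup (cycleNbhd 6) i →
    (∃[ a ] ∃[ b ] (side i ≡ inj₁ a × side j ≡ inj₂ b)) ⊎ (∃[ a ] ∃[ b ] (side i ≡ inj₂ a × side j ≡ inj₁ b))
  sides-differ = from-yes (all₂? {6} {6} λ i j → cycle~? 6 i j →-dec
    ((Fin.any? λ a → Fin.any? λ b → (side i ≟ₛ inj₁ a) ×-dec (side j ≟ₛ inj₂ b))
      ⊎-dec (Fin.any? λ a → Fin.any? λ b → (side i ≟ₛ inj₂ a) ×-dec (side j ≟ₛ inj₁ b))))

  cycle₆ : Triple → Fin 6 → Fin n
  cycle₆ t i = place t (side i)

  cycle₆-inj : ∀ t → Injective _≡_ _≡_ (cycle₆ t)
  cycle₆-inj t {i} {j} e = side-inj i j (place-inj t (side i) (side j) e)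

  cycle₆-hom : ∀ t i j → j Subset.∈ Vec.lookup (cycleNbhd 6) i → Graph._~_ G (cycle₆ t i) (cycle₆ t j)
  cycle₆-hom t i j i~j = Equivalence.from (∈-matrix⇔ (across? n) (cycle₆ t i) (cycle₆ t j)) (go (sides-differ i j i~j))
    where
    go : _ → Across n (cycle₆ t i) (cycle₆ t j)
    go (inj₁ (a , b , e , e′)) rewrite e | e′ = inj₁ (low-place t a , ¬low-place t b)
    go (inj₂ (a , b , e , e′)) rewrite e | e′ = inj₂ (¬low-place t a , low-place t b)

  triple-hexagon : Triple → VE n
  triple-hexagon t = image (Cycle 6) (cycle₆ t)

  triple-isCopy : ∀ t → IsCopy (Cycle 6) G (triple-hexagon t)
  triple-isCopy t = image-isCopy (Cycle 6) (cycle₆ t) G (cycle₆-inj t) (λ {i} {j} → cycle₆-hom t i j)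

  triple-isHexagon : ∀ t → Hexagon G (triple-hexagon t) (cycle₆ t ∘ even) (cycle₆ t ∘ odd)
  triple-isHexagon t = let (S⊑G , f , inj , im , adj) = triple-isCopy t in isIso⇒hexagon S⊑G f inj im adj

  -- The labels of the three low vertices are fixed, so the subgraph determines the vertex opposite
  -- to each, and with them the ordered triple.
  triple-hexagon-inj : ∀ {t t′} → triple-hexagon t ≡ triple-hexagon t′ → t ≡ t′
  triple-hexagon-inj {t} {t′} e = distinct-triple-determines λ i → sym (Fin.↑ʳ-injective 3 _ _
    (subst₂ (λ p q → place t′ p ≡ place t q) (side-odd i) (side-odd i) (same i)))
    where
    same : cycle₆ t′ ∘ odd ≗ cycle₆ t ∘ odd
    same = hexagon-opposites-unique {x = cycle₆ t ∘ even}
      (λ i → subst (λ p → place t p ≡ place t′ p) (sym (side-even i)) refl)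
      (λ i j → apart i j)
      (triple-isHexagon t) (subst (λ S → Hexagon G S (cycle₆ t′ ∘ even) (cycle₆ t′ ∘ odd)) (sym e) (triple-isHexagon t′))
      where
      apart : ∀ i j → cycle₆ t (even i) ≢ cycle₆ t (odd j)
      apart i j eq = contradiction
        (trans (sym (side-even i)) (trans (place-inj t (side (even i)) (side (odd j)) eq) (side-odd j))) λ ()

  #C₆≥ : (2 + k) * ((1 + k) * k) ≤ #copies (Cycle 6) G
  #C₆≥ = subst (_≤ #copies (Cycle 6) G) length-triples
    (length-injects (λ t S → S ≡ triple-hexagon t) triples-unique
      (λ {t} _ → triple-hexagon t , Equivalence.from (∈-copies (Cycle 6) G _) (triple-isCopy t) , refl)
      (λ e e′ → triple-hexagon-inj (trans (sym e) e′)))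

-- Combining the two bounds

admissible⇒≤exbip : ∀ {n} (G : Graph n) → Admissible (Cycle 8) G → #copies (Cycle 6) G ≤ exbip n 6 8
admissible⇒≤exbip {n} = proj₂ (exbip-isExBip n 6 8)

exbip-attained : ∀ n → ∃[ G ] Admissible {n = n} (Cycle 8) G × #copies (Cycle 6) G ≡ exbip n 6 8
exbip-attained n = proj₁ (exbip-isExBip n 6 8)

exbip≤ : ∀ n → ∃[ m ] (exbip n 6 8 ≤ n ^ 3 + n * m * 90 × m * m ≤ 10 * (n * (n * n)))
exbip≤ n =
  let (G , (bip , C₈-free) , #≡) = exbip-attained n in
  ∑[ w < n ] degree G w ,
  subst (_≤ n ^ 3 + n * ∑[ w < n ] degree G w * 90) #≡ (#C₆≤ G bip C₈-free) ,
  ∑degree²≤ G bip C₈-free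

cube≤ : ∀ k → (5 + k) ^ 3 ≤ (2 + k) * ((1 + k) * k) + 12 * ((5 + k) * (5 + k))
-- With n = 5 + k, the triples fall short of n³ by 12k² + 73k + 125, and 12n² exceeds this by 47k +
-- 175.
cube≤ k = subst ((5 + k) ^ 3 ≤_) (identity k) (m≤m+n ((5 + k) ^ 3) (47 * k + 175))
  where
  open +-*-Solver
  identity : ∀ k → (5 + k) ^ 3 + (47 * k + 175) ≡ (2 + k) * ((1 + k) * k) + 12 * ((5 + k) * (5 + k))
  identity = solve 1 (λ k → let n = con 5 :+ k in
    n :* (n :* (n :* con 1)) :+ (con 47 :* k :+ con 175)
      := (con 2 :+ k) :* ((con 1 :+ k) :* k) :+ con 12 :* (n :* n)) refl

∣-∣²≤ : ∀ {a b c d e} → a ≤ b + c → b ≤ a + d → c ^ 2 ≤ e → d ^ 2 ≤ e → ∣ a - b ∣ ^ 2 ≤ e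
∣-∣²≤ {a} {b} {c} {d} a≤ b≤ c²≤ d²≤ with ≤-total a b
... | inj₁ a≤b = ≤-trans (^-monoˡ-≤ 2 (subst (_≤ d) (sym (m≤n⇒∣m-n∣≡n∸m a≤b)) (m≤n+o⇒m∸n≤o b a b≤))) d²≤
... | inj₂ b≤a = ≤-trans (^-monoˡ-≤ 2 (subst (_≤ c) (sym (m≤n⇒∣n-m∣≡n∸m b≤a)) (m≤n+o⇒m∸n≤o a b a≤))) c²≤

-- The bound by C times n to the power 5/2 is squared in order to stay within the natural numbers.
theorem10 : ∃[ C ] ∃[ n₀ ] ∀ (n : ℕ) → n₀ ≤ n →
    ∣ exbip n 6 8 - n ^ 3 ∣ ^ 2 ≤ C ^ 2 * n ^ 5
-- 300² = 90000 is at least 90² · 10 = 81000, which the upper bound requires; 5 is the least order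
-- for which n = 5 + k in the lower bound.
theorem10 = 300 , 5 , bound
  where
  open ≤-Reasoning
  upper : ∀ n m → m * m ≤ 10 * (n * (n * n)) → (n * m * 90) ^ 2 ≤ 300 ^ 2 * n ^ 5
  upper n m m²≤ = begin
    (n * m * 90) ^ 2                           ≡⟨ square n m ⟩
    8100 * (n * n) * (m * m)                   ≤⟨ *-monoʳ-≤ (8100 * (n * n)) m²≤ ⟩
    8100 * (n * n) * (10 * (n * (n * n)))      ≡⟨ fifth n ⟩
    81000 * n ^ 5                              ≤⟨ *-monoˡ-≤ (n ^ 5) (≤ᵇ⇒≤ 81000 (300 ^ 2) _) ⟩
    300 ^ 2 * n ^ 5                            ∎
    where
    open +-*-Solver
    square : ∀ n m → (n * m * 90) ^ 2 ≡ 8100 * (n * n) * (m * m)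
    square = solve 2 (λ n m → let p = n :* m :* con 90 in
      p :* (p :* con 1) := con 8100 :* (n :* n) :* (m :* m)) refl
    fifth : ∀ n → 8100 * (n * n) * (10 * (n * (n * n))) ≡ 81000 * n ^ 5
    fifth = solve 1 (λ n → con 8100 :* (n :* n) :* (con 10 :* (n :* (n :* n)))
      := con 81000 :* (n :* (n :* (n :* (n :* (n :* con 1)))))) refl

  lower : ∀ n → 1 ≤ n → (12 * (n * n)) ^ 2 ≤ 300 ^ 2 * n ^ 5
  lower n 1≤n = begin
    (12 * (n * n)) ^ 2   ≡⟨ square n ⟩
    -- The factor 1 is kept because `n ^ 5` unfolds to `n * n ^ 4`, so that 1 ≤ n applies directly.
    144 * (1 * n ^ 4)    ≤⟨ *-mono-≤ (≤ᵇ⇒≤ 144 (300 ^ 2) _) (*-monoˡ-≤ (n ^ 4) 1≤n) ⟩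
    300 ^ 2 * n ^ 5      ∎
    where
    open +-*-Solver
    square : ∀ n → (12 * (n * n)) ^ 2 ≡ 144 * (1 * n ^ 4)
    square = solve 1 (λ n → let p = con 12 :* (n :* n) in
      p :* (p :* con 1) := con 144 :* (con 1 :* (n :* (n :* (n :* (n :* con 1)))))) refl

  cube≤exbip : ∀ n → 5 ≤ n → n ^ 3 ≤ exbip n 6 8 + 12 * (n * n)
  cube≤exbip n 5≤n =
    let (k , 5+k≡n) = m≤n⇒∃[o]m+o≡n 5≤n
        admissible = K₃,ₙ₋₃-bipartite (5 + k) , K₃,ₙ₋₃-C₈-free (5 + k)
    in subst (λ n → n ^ 3 ≤ exbip n 6 8 + 12 * (n * n)) 5+k≡n
      (≤-trans (cube≤ k) (+-monoˡ-≤ (12 * ((5 + k) * (5 + k)))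
        (≤-trans (#C₆≥ k) (admissible⇒≤exbip (K₃,ₙ₋₃ (5 + k)) admissible))))

  bound : ∀ n → 5 ≤ n → ∣ exbip n 6 8 - n ^ 3 ∣ ^ 2 ≤ 300 ^ 2 * n ^ 5
  bound n 5≤n =
    let (m , ex≤ , m²≤) = exbip≤ n
    in ∣-∣²≤ {a = exbip n 6 8} {b = n ^ 3} ex≤ (cube≤exbip n 5≤n)
         (upper n m m²≤) (lower n (≤-trans (s≤s z≤n) 5≤n))
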